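{- Let $k>3$ be an integer. Then \[\mathcal{L}_2S_k(2k)=\{n\geq 2k-1\mid n\equiv 0,1\pmod 4\},\] and for every $v>2k$ with $v(v-1)\equiv 0\pmod{2k}$, \[\mathcal{L}_2S_k(v)=\{n\geq v\mid n\equiv 0,1\pmod 4\}.\]
   Context: All graphs are finite and simple; $\Gamma\leq K$ means $\Gamma$ is a subgraph of $K$ (or is isomorphic to one, when $\Gamma$ is an abstract graph). $P_3$ is the path on $3$ vertices; $S_k$ is the star on $k+1$ vertices, i.e. the complete bipartite graph $K_{1,k}$. For a graph $K$ and $\Gamma\leq K$, a $(K,\Gamma)$-design is a set $\mathcal{B}$ of subgraphs of $K$, called blocks, each isomorphic to $\Gamma$, whose edge-sets partition $E(K)$. $K_n$ is the complete graph on a set of $n$ vertices (any $n$-element vertex set may be used); a $\Gamma$-design of order $n$ is a $(K_n,\Gamma)$-design. Given $\Gamma'\leq\Gamma$, a $(K,\Gamma)$-design $\mathcal{B}$ and a $(K',\Gamma')$-design $\mathcal{B}'$, a down-link from $\mathcal{B}$ to $\mathcal{B}'$ is a function $f:\mathcal{B}\to\mathcal{B}'$ such that $f(B)$ is a subgraph of $B$ for every $B\in\mathcal{B}$ (the vertex sets of $K$ and $K'$ need not coincide, and either may be the larger). Take $\Gamma'=P_3$. For $v$ such that a $(K_v,\Gamma)$-design exists, $\mathcal{L}_2\Gamma(v)$ is the set of all integers $n$ such that every $\Gamma$-design of order $v$ can be down-linked to a $P_3$-design of order $n$. A $(K_v,S_k)$-design exists if and only if $v\geq 2k$ and $v(v-1)\equiv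 0\pmod{2k}$. -}

module Defs where

open import Data.Nat using (ℕ; suc; _<_; _<?_; _≟_; z<s)
open import Data.Fin using (Fin)
open import Data.List using (List; length; upTo)
open import Data.List.Membership.Propositional using (_∈_)
open import Data.List.Membership.Propositional.Properties using (∈-upTo⁺)
open import Data.List.Membership.DecPropositional _≟_ using (_∈?_)
open import Data.List.Relation.Binary.Subset.Propositional using (_⊆_)
open import Data.List.Relation.Unary.Unique.Propositional using (Unique)
open import Data.List.Relation.Unary.Unique.Propositional.Properties using (upTo⁺)
open import Data.Product using (Σ; ∃; _×_; _,_; proj₁)
open import Data.Sum using (_⊎_; inj₁; inj₂; swap)
open import Level using (0ℓ) renaming (suc to lsuc)
open import Relation.Binary using (Rel; Decidable; Symmetric; Irreflexive; _⇒_)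
open import Relation.Binary.PropositionalEquality using (_≡_; _≢_; refl; sym)
open import Relation.Nullary.Decidable using (_×-dec_; _⊎-dec_; ¬?)
open import Relation.Unary using (Pred)

-- All vertices are drawn from the one infinite set ℕ, so that graphs with
-- different vertex sets can be compared by inclusion.  A finite vertex set is
-- a duplicate-free list, whose order is irrelevant to every notion below.
record Graph : Set₁ where
  field
    vertices : List ℕ
    unique   : Unique vertices
    Adj      : Rel ℕ 0ℓ
    adj?     : Decidable Adj
    adj-sym  : Symmetric Adj
    adj-irr  : Irreflexive _≡_ Adj
    adj-∈    : ∀ {x y} → Adj x y → x ∈ vertices


open Graph public

infix 4 _≤ᴳ_ _≈ᴳ_ _≅_

_≤ᴳ_ : Rel Graph 0ℓ
G ≤ᴳ H = vertices G ⊆ vertices H × Adj G ⇒ Adj H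

_≈ᴳ_ : Rel Graph 0ℓ
G ≈ᴳ H = G ≤ᴳ H × H ≤ᴳ G

-- The values of to and from outside the vertex sets are irrelevant.
record _≅_ (G H : Graph) : Set where
  field
    to from  : ℕ → ℕ
    to-∈     : ∀ {x} → x ∈ vertices G → to x ∈ vertices H
    from-∈   : ∀ {y} → y ∈ vertices H → from y ∈ vertices G
    from∘to  : ∀ {x} → x ∈ vertices G → from (to x) ≡ x
    to∘from  : ∀ {y} → y ∈ vertices H → to (from y) ≡ y
    to-adj   : ∀ {x y} → Adj G x y → Adj H (to x) (to y)
    from-adj : ∀ {x y} → Adj H x y → Adj G (from x) (from y)

complete : (V : List ℕ) → Unique V → Graph
complete V u = record
  { vertices = V
  ; unique   = u
  ; Adj      = λ x y → x ∈ V × y ∈ V × x ≢ y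
  ; adj?     = λ x y → (x ∈? V) ×-dec (y ∈? V) ×-dec ¬? (x ≟ y)
  ; adj-sym  = λ (x∈ , y∈ , x≢y) → y∈ , x∈ , λ y≡x → x≢y (sym y≡x)
  ; adj-irr  = λ x≡y (_ , _ , x≢y) → x≢y x≡y
  ; adj-∈    = proj₁
  }

-- The path on n vertices 0, 1, …, n - 1.
path : ℕ → Graph
path n = record
  { vertices = upTo n
  ; unique   = upTo⁺ n
  ; Adj      = λ x y → x < n × y < n × (suc x ≡ y ⊎ suc y ≡ x)
  ; adj?     = λ x y → (x <? n) ×-dec (y <? n) ×-dec ((suc x ≟ y) ⊎-dec (suc y ≟ x))
  ; adj-sym  = λ (x< , y< , e) → y< , x< , swap e
  ; adj-irr  = λ { refl (_ , _ , inj₁ ()) ; refl (_ , _ , inj₂ ()) }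
  ; adj-∈    = λ (x< , _) → ∈-upTo⁺ x<
  }

-- The star on k + 1 vertices: centre 0 and leaves 1, …, k.
star : ℕ → Graph
star k = record
  { vertices = upTo (suc k)
  ; unique   = upTo⁺ (suc k)
  ; Adj      = λ x y → Spoke x y ⊎ Spoke y x
  ; adj?     = λ x y → spoke? x y ⊎-dec spoke? y x
  ; adj-sym  = swap
  ; adj-irr  = λ { refl (inj₁ (refl , () , _)) ; refl (inj₂ (refl , () , _)) }
  ; adj-∈    = λ { (inj₁ (refl , _)) → ∈-upTo⁺ z<s
                 ; (inj₂ (_ , _ , x<)) → ∈-upTo⁺ x< }
  }
  where
  Spoke : Rel ℕ 0ℓ
  Spoke x y = x ≡ 0 × 0 < y × y < suc k

  spoke? : Decidable Spoke
  spoke? x y = (x ≟ 0) ×-dec (0 <? y) ×-dec (y <? suc k)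

-- The set of blocks is enumerated without repetition by Fin size; distinctness
-- is stated separately because the partition property only implies it when Γ
-- has an edge.
record Design (K Γ : Graph) : Set₁ where
  field
    size     : ℕ
    block    : Fin size → Graph
    distinct : ∀ {i j} → block i ≈ᴳ block j → i ≡ j
    block≤   : ∀ i → block i ≤ᴳ K
    block≅   : ∀ i → block i ≅ Γ
    cover    : ∀ {x y} → Adj K x y → ∃ λ i → Adj (block i) x y
    disjoint : ∀ {i j x y} → Adj (block i) x y → Adj (block j) x y → i ≡ j

open Design public

DownLink : ∀ {K Γ K′ Γ′} → Design K Γ → Design K′ Γ′ → Set
DownLink 𝓑 𝓑′ = Σ (Fin (size 𝓑) → Fin (size 𝓑′)) λ f →
  ∀ i → block 𝓑′ (f i) ≤ᴳ block 𝓑 i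

𝓛₂ : Graph → ℕ → Pred ℕ (lsuc 0ℓ)
𝓛₂ Γ v n =
  ∀ (V : List ℕ) (u : Unique V) → length V ≡ v →
  (𝓑 : Design (complete V u) Γ) →
  Σ (List ℕ) λ V′ → Σ (Unique V′) λ u′ → length V′ ≡ n ×
  Σ (Design (complete V′ u′) (path 3)) λ 𝓑′ → DownLink 𝓑 𝓑′

{-# OPTIONS --safe #-}
module Submission where

open import Algebra.Bundles using (CommutativeRing)
import Algebra.Properties.CommutativeSemigroup as CommutativeSemigroupProperties
open import Data.Bool using (Bool; true; false; not; _xor_; _∧_; _∨_; T; if_then_else_)
import Data.Bool as Bool
open import Data.Bool.Properties using (xor-comm; xor-same; xor-identityʳ; not-involutive; not-distribˡ-xor; ∨-comm; ∧-comm; ∧-zeroʳ; ∧-identityʳ; xor-∧-commutativeRing)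
open import Data.Empty using (⊥-elim)
open import Data.Fin using (Fin; zero; suc)
import Data.Fin as Fin
import Data.Fin.Properties as Fin
open import Data.List using (List; []; _∷_; _++_; length; lookup; map; filter; concat; take; drop; upTo; applyUpTo; allFin)
open import Data.List.Membership.Propositional using (_∈_; _∉_; find; lose)
open import Data.List.Membership.Propositional.Properties using (∈-∃++; ∈-++⁺ˡ; ∈-++⁺ʳ; ∈-++⁻; ∈-map⁺; ∈-map⁻; ∈-concat⁺′; ∈-concat⁻′; ∈-filter⁺; ∈-filter⁻; ∈-lookup; ∈-allFin; ∈-upTo⁺; ∈-upTo⁻; ∈-applyUpTo⁺; ∈-applyUpTo⁻)
open import Data.List.Properties using (length-++; length-map; length-take; length-drop; length-upTo; length-applyUpTo; length-tabulate; take-[]; take-all; take++drop≡id; concat-++)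
open import Data.List.Relation.Binary.Disjoint.Propositional using (Disjoint)
open import Data.List.Relation.Binary.Subset.Propositional using (_⊆_)
open import Data.List.Relation.Unary.All as All using (All; []; _∷_)
import Data.List.Relation.Unary.All.Properties as All
open import Data.List.Relation.Unary.AllPairs as AllPairs using (AllPairs; []; _∷_)
import Data.List.Relation.Unary.AllPairs.Properties as AllPairs
open import Data.List.Relation.Unary.Any as Any using (here; there; index)
open import Data.List.Relation.Unary.Any.Properties using (lookup-index)
open import Data.List.Relation.Unary.Unique.Propositional using (Unique)
open import Data.List.Relation.Unary.Unique.Propositional.Properties using (Unique[x∷xs]⇒x∉xs; map⁺; ++⁺; concat⁺; take⁺; filter⁺; upTo⁺; applyUpTo⁺₁; allFin⁺)
open import Data.Nat
open import Data.Nat.Divisibility using (_∣_; divides; ∣m+n∣m⇒∣n; n∣m*n)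
open import Data.Nat.DivMod using (_/_; _%_; m≡m%n+[m/n]*n; m%n<n; m*n/n≡m; m≥n⇒m/n>0)
open import Data.Nat.ListAction using (sum)
open import Data.Nat.Properties
open import Data.Nat.Tactic.RingSolver using (solve-∀)
open import Data.Product using (Σ; ∃; ∃₂; _×_; _,_; proj₁; proj₂)
open import Data.Sum using (_⊎_; inj₁; inj₂; swap; [_,_]′)
open import Function using (_∘_; case_of_; id)
open import Level using (0ℓ)
open import Relation.Binary using (Rel; Symmetric)
open import Relation.Binary.Definitions using (tri<; tri≈; tri>)
open import Relation.Binary.PropositionalEquality
open import Relation.Nullary using (¬_; Dec; yes; no; does; contradiction)
open import Relation.Nullary.Decidable using (dec-true; dec-false; ¬?; _×-dec_; _⊎-dec_)
open import Relation.Unary using (_≐_)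
open import Data.List.Membership.DecPropositional _≟_ using (_∈?_)
open import Defs

-- A design with blocks S_k amounts to an orientation of K_v (away from the centres)
-- in which every out-neighbourhood is split into k-sets; likewise a P_3-design is
-- an orientation of K_n with all out-degrees even, the out-neighbours being paired.
--
-- Lower bounds.  A P_3 inside a star has the same centre, so the centres lie in
-- K_n, and counting edges gives 4 ∣ n(n - 1).  A star design with v centres, or with
-- 2k - 1 of them if v = 2k, comes from a tournament whose scores are the two
-- multiples of k nearest (v - 1)/2.  It is reached from the transitive tournament:
-- a unit of score can be moved from x to y whenever score x ≥ score y.
--
-- Construction for n ≥ v.  Orient K_n compatibly with the stars and fix a hub h in
-- K_v.  Each vertex of odd out-degree reverses its edge to h, and then h is even too,
-- because n(n - 1)/2 is.  A star centred at h must keep two of its edges; their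
-- leaves first repair their parity through a third leaf of that star instead.  In
-- every other star at most two edges can get reversed, so with k > 3 two remain.

-- Cardinalities of duplicate-free lists.

unique-⊆-length : ∀ {A : Set} {xs ys : List A} → Unique xs → xs ⊆ ys → length xs ≤ length ys
unique-⊆-length {xs = []} _ _ = z≤n
unique-⊆-length {xs = x ∷ xs} (x≢ ∷ u) sub with ∈-∃++ (sub (here refl))
... | as , bs , refl = subst (suc (length xs) ≤_) (sym eq) (s≤s (unique-⊆-length u sub′))
  where
  sub′ : xs ⊆ as ++ bs
  sub′ z∈ with ∈-++⁻ as (sub (there z∈))
  ... | inj₁ z∈as = ∈-++⁺ˡ z∈as
  ... | inj₂ (here refl) = contradiction refl (All.lookup x≢ z∈)
  ... | inj₂ (there z∈bs) = ∈-++⁺ʳ as z∈bs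
  eq : length (as ++ x ∷ bs) ≡ suc (length (as ++ bs))
  eq rewrite length-++ as {x ∷ bs} | length-++ as {bs} = +-suc (length as) (length bs)

unique-⊆⊇-length : ∀ {A : Set} {xs ys : List A} → Unique xs → Unique ys →
                   xs ⊆ ys → ys ⊆ xs → length xs ≡ length ys
unique-⊆⊇-length u u′ s s′ = ≤-antisym (unique-⊆-length u s) (unique-⊆-length u′ s′)

allPairs-∈ : ∀ {A : Set} {R : A → A → Set} {xs} → (∀ {x y} → x ∈ xs → y ∈ xs → x ≢ y → R x y) →
             Unique xs → AllPairs R xs
allPairs-∈ r [] = []
allPairs-∈ r (x≢ ∷ u) = All.tabulate (λ y∈ → r (here refl) (there y∈) (All.lookup x≢ y∈))
                      ∷ allPairs-∈ (λ p q → r (there p) (there q)) u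

unique-map : ∀ {A B : Set} {f : A → B} {xs} → (∀ {x y} → x ∈ xs → y ∈ xs → f x ≡ f y → x ≡ y) →
             Unique xs → Unique (map f xs)
unique-map inj u = AllPairs.map⁺ (allPairs-∈ (λ x∈ y∈ x≢y → x≢y ∘ inj x∈ y∈) u)

-- Sums and parity

sumOver : ∀ {A : Set} → List A → (A → ℕ) → ℕ
sumOver xs f = sum (map f xs)

sumOver-cong : ∀ {A : Set} (xs : List A) {f g : A → ℕ} → (∀ {x} → x ∈ xs → f x ≡ g x) →
               sumOver xs f ≡ sumOver xs g
sumOver-cong [] eq = refl
sumOver-cong (x ∷ xs) eq = cong₂ _+_ (eq (here refl)) (sumOver-cong xs (eq ∘ there))

sumOver-+ : ∀ {A : Set} (xs : List A) (f g : A → ℕ) →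
            sumOver xs (λ x → f x + g x) ≡ sumOver xs f + sumOver xs g
sumOver-+ [] f g = refl
sumOver-+ (x ∷ xs) f g rewrite sumOver-+ xs f g = lemma (f x) (g x) (sumOver xs f) (sumOver xs g)
  where
  lemma : ∀ a b c d → a + b + (c + d) ≡ a + c + (b + d)
  lemma = solve-∀

sumOver-*ˡ : ∀ {A : Set} (xs : List A) c (f : A → ℕ) → sumOver xs (λ x → c * f x) ≡ c * sumOver xs f
sumOver-*ˡ [] c f = sym (*-zeroʳ c)
sumOver-*ˡ (x ∷ xs) c f rewrite sumOver-*ˡ xs c f = sym (*-distribˡ-+ c (f x) (sumOver xs f))

sumOver-const : ∀ {A : Set} (xs : List A) c → sumOver xs (λ _ → c) ≡ length xs * c
sumOver-const [] c = refl
sumOver-const (x ∷ xs) c = cong (c +_) (sumOver-const xs c)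

sumOver-++ : ∀ {A : Set} (xs ys : List A) (f : A → ℕ) → sumOver (xs ++ ys) f ≡ sumOver xs f + sumOver ys f
sumOver-++ [] ys f = refl
sumOver-++ (x ∷ xs) ys f rewrite sumOver-++ xs ys f = sym (+-assoc (f x) _ _)

sumOver-mono : ∀ {A : Set} (xs : List A) {f g : A → ℕ} → (∀ {x} → x ∈ xs → f x ≤ g x) →
               sumOver xs f ≤ sumOver xs g
sumOver-mono [] le = z≤n
sumOver-mono (x ∷ xs) le = +-mono-≤ (le (here refl)) (sumOver-mono xs (le ∘ there))

sumOver-mono-< : ∀ {A : Set} (xs : List A) {f g : A → ℕ} → (∀ {x} → x ∈ xs → f x ≤ g x) →
                 ∀ {z} → z ∈ xs → f z < g z → sumOver xs f < sumOver xs g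
sumOver-mono-< (x ∷ xs) le (here refl) lt = +-mono-<-≤ lt (sumOver-mono xs (le ∘ there))
sumOver-mono-< (x ∷ xs) le (there z∈) lt = +-mono-≤-< (le (here refl)) (sumOver-mono-< xs (le ∘ there) z∈ lt)

sumOver-mono-≡ : ∀ {A : Set} (xs : List A) {f g : A → ℕ} → (∀ {x} → x ∈ xs → f x ≤ g x) →
                 sumOver xs f ≡ sumOver xs g → ∀ {z} → z ∈ xs → f z ≡ g z
sumOver-mono-≡ xs {f} {g} le eq {z} z∈ with m≤n⇒m<n∨m≡n (le z∈)
... | inj₁ lt = contradiction eq (<⇒≢ (sumOver-mono-< xs le z∈ lt))
... | inj₂ e = e

module _ {A B C : Set} (f : A → B) (g : A → List C) where

  -- Used for the list of stars with their centres and, for double counting, for the list of arcs: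
  -- once grouped by block and once by tail.
  labelled : List A → List (B × C)
  labelled xs = concat (map (λ a → map (f a ,_) (g a)) xs)

  ∈-labelled⁺ : ∀ {xs a y} → a ∈ xs → y ∈ g a → (f a , y) ∈ labelled xs
  ∈-labelled⁺ {a = a} a∈ y∈ = ∈-concat⁺′ (∈-map⁺ (f a ,_) y∈) (∈-map⁺ (λ a → map (f a ,_) (g a)) a∈)

  ∈-labelled⁻ : ∀ {xs x y} → (x , y) ∈ labelled xs → ∃ λ a → a ∈ xs × x ≡ f a × y ∈ g a
  ∈-labelled⁻ {xs} p∈ with ∈-concat⁻′ (map (λ a → map (f a ,_) (g a)) xs) p∈
  ... | _ , p∈ps , ps∈ with ∈-map⁻ (λ a → map (f a ,_) (g a)) ps∈
  ... | a , a∈ , refl with ∈-map⁻ (f a ,_) p∈ps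
  ... | y , y∈ , refl = a , a∈ , refl , y∈

  length-labelled : ∀ xs → length (labelled xs) ≡ sumOver xs (length ∘ g)
  length-labelled [] = refl
  length-labelled (x ∷ xs) = trans (length-++ (map (f x ,_) (g x)))
    (cong₂ _+_ (length-map (f x ,_) (g x)) (length-labelled xs))

  -- The label map need not be injective: several blocks may share a centre as long as they have no
  -- leaf in common.
  labelled-unique : ∀ {xs} → Unique xs → (∀ a → Unique (g a)) →
                    (∀ {a b y} → f a ≡ f b → y ∈ g a → y ∈ g b → a ≡ b) → Unique (labelled xs)
  labelled-unique u ug apart = concat⁺
    (All.map⁺ (All.tabulate λ {a} _ → map⁺ (λ { refl → refl }) (ug a)))
    (AllPairs.map⁺ (AllPairs.map separate u))
    where
    same : ∀ {a b p} → p ∈ map (f a ,_) (g a) → p ∈ map (f b ,_) (g b) → a ≡ b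
    same {a} {b} p∈a p∈b with ∈-map⁻ (f a ,_) p∈a | ∈-map⁻ (f b ,_) p∈b
    ... | y , y∈a , refl | y′ , y∈b , eq =
      apart (cong proj₁ eq) y∈a (subst (_∈ g b) (sym (cong proj₂ eq)) y∈b)
    separate : ∀ {a b} → a ≢ b → Disjoint (map (f a ,_) (g a)) (map (f b ,_) (g b))
    separate a≢b (p∈a , p∈b) = a≢b (same p∈a p∈b)

⟦_⟧ : Bool → ℕ
⟦ true ⟧ = 1
⟦ false ⟧ = 0

δ : ℕ → ℕ → Bool
δ x y = does (x ≟ y)

δ-refl : ∀ x → δ x x ≡ true
δ-refl x = dec-true (x ≟ x) refl

δ-≢ : ∀ {x y} → x ≢ y → δ x y ≡ false
δ-≢ {x} {y} = dec-false (x ≟ y)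

δ-true : ∀ {x y} → δ x y ≡ true → x ≡ y
δ-true {x} {y} eq = ≡ᵇ⇒≡ x y (subst T (sym eq) _)

sumOver-zero : ∀ {A : Set} (xs : List A) {f : A → ℕ} → (∀ {x} → x ∈ xs → f x ≡ 0) → sumOver xs f ≡ 0
sumOver-zero xs eq = trans (sumOver-cong xs eq) (trans (sumOver-const xs 0) (*-zeroʳ (length xs)))

sumOver-δ : ∀ {xs z} → Unique xs → z ∈ xs → sumOver xs (λ y → ⟦ δ z y ⟧) ≡ 1
sumOver-δ {x ∷ xs} {z} (x≢ ∷ u) (here refl) rewrite δ-refl x =
  cong suc (sumOver-zero xs λ y∈ → cong ⟦_⟧ (δ-≢ (All.lookup x≢ y∈)))
sumOver-δ {x ∷ xs} {z} (x≢ ∷ u) (there z∈) rewrite δ-≢ {z} {x} (λ { refl → All.lookup x≢ z∈ refl }) =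
  sumOver-δ u z∈

length-filter-true : ∀ (f : ℕ → Bool) xs → length (filter (λ x → f x Bool.≟ true) xs) ≡ sumOver xs (⟦_⟧ ∘ f)
length-filter-true f [] = refl
length-filter-true f (x ∷ xs) with f x
... | true = cong suc (length-filter-true f xs)
... | false = length-filter-true f xs

odd : ℕ → Bool
odd zero = false
odd (suc n) = not (odd n)

xorOver : ∀ {A : Set} → List A → (A → Bool) → Bool
xorOver [] f = false
xorOver (x ∷ xs) f = f x xor xorOver xs f

odd-+ : ∀ m n → odd (m + n) ≡ odd m xor odd n
odd-+ zero n = refl
odd-+ (suc m) n rewrite odd-+ m n with odd m
... | true = not-involutive (odd n)
... | false = refl

odd-sumOver : ∀ {A : Set} (xs : List A) (f : A → ℕ) → odd (sumOver xs f) ≡ xorOver xs (odd ∘ f)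
odd-sumOver [] f = refl
odd-sumOver (x ∷ xs) f rewrite odd-+ (f x) (sumOver xs f) | odd-sumOver xs f = refl

odd-⟦⟧ : ∀ b → odd ⟦ b ⟧ ≡ b
odd-⟦⟧ true = refl
odd-⟦⟧ false = refl

xorOver-cong : ∀ {A : Set} (xs : List A) {f g : A → Bool} → (∀ {x} → x ∈ xs → f x ≡ g x) →
               xorOver xs f ≡ xorOver xs g
xorOver-cong [] eq = refl
xorOver-cong (x ∷ xs) eq = cong₂ _xor_ (eq (here refl)) (xorOver-cong xs (eq ∘ there))

module XorSemigroup = CommutativeSemigroupProperties (CommutativeRing.+-commutativeSemigroup xor-∧-commutativeRing)

xorOver-xor : ∀ {A : Set} (xs : List A) (f g : A → Bool) →
              xorOver xs (λ x → f x xor g x) ≡ xorOver xs f xor xorOver xs g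
xorOver-xor [] f g = refl
xorOver-xor (x ∷ xs) f g rewrite xorOver-xor xs f g = XorSemigroup.interchange (f x) (g x) (xorOver xs f) (xorOver xs g)

xorOver-false : ∀ {A : Set} (xs : List A) {f : A → Bool} → (∀ {x} → x ∈ xs → f x ≡ false) → xorOver xs f ≡ false
xorOver-false [] _ = refl
xorOver-false (x ∷ xs) eq = cong₂ _xor_ (eq (here refl)) (xorOver-false xs (eq ∘ there))

xorOver-δ : ∀ {xs z} c → Unique xs → z ∈ xs → xorOver xs (λ y → c ∧ δ z y) ≡ c
xorOver-δ {xs} false _ _ = xorOver-false xs (λ _ → refl)
xorOver-δ {xs} {z} true u z∈ = begin
  xorOver xs (δ z)                     ≡⟨ xorOver-cong xs (λ {y} _ → odd-⟦⟧ (δ z y)) ⟨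
  xorOver xs (λ y → odd ⟦ δ z y ⟧)     ≡⟨ odd-sumOver xs _ ⟨
  odd (sumOver xs (λ y → ⟦ δ z y ⟧))   ≡⟨ cong odd (sumOver-δ u z∈) ⟩
  true                                 ∎
  where open ≡-Reasoning

even⇒double : ∀ n → odd n ≡ false → ∃ λ m → n ≡ m * 2
even⇒double zero _ = 0 , refl
even⇒double (suc (suc n)) e with even⇒double n (trans (sym (not-involutive (odd n))) e)
... | m , refl = suc m , refl

odd-double : ∀ m → odd (m * 2) ≡ false
odd-double zero = refl
odd-double (suc m) rewrite odd-double m = refl

-- Tournaments

record Tournament : Set where
  field
    beats : ℕ → ℕ → Bool
    irrefl : ∀ x → beats x x ≡ false
    total  : ∀ {x y} → x ≢ y → beats x y ≡ not (beats y x)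

open Tournament public

beats⇒≢ : ∀ (D : Tournament) {x y} → beats D x y ≡ true → x ≢ y
beats⇒≢ D {x} b refl with () ← trans (sym b) (irrefl D x)

beats-asym : ∀ (D : Tournament) {x y} → beats D x y ≡ true → beats D y x ≡ false
beats-asym D {x} {y} b = trans (total D (beats⇒≢ D b ∘ sym)) (cong not b)

beats-total : ∀ (D : Tournament) {x y} → x ≢ y → beats D x y ≡ true ⊎ beats D y x ≡ true
beats-total D {x} {y} x≢y with beats D x y | beats D y x | total D x≢y
... | true | _ | _ = inj₁ refl
... | false | true | _ = inj₂ refl

deg : Tournament → List ℕ → ℕ → ℕ
deg D V x = sumOver V (⟦_⟧ ∘ beats D x)

-- Induction on the list: `x` meets each of the other `n` vertices once, in `a` wins and `b` losses,
-- so these arcs add `n` to the sum. The factor 2 avoids a division.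
sum-deg : ∀ (D : Tournament) {xs} → Unique xs → sumOver xs (deg D xs) * 2 ≡ length xs * (length xs ∸ 1)
sum-deg D [] = refl
sum-deg D {x ∷ xs} (x≢ ∷ u)
  rewrite irrefl D x
        | sumOver-+ xs (λ y → ⟦ beats D y x ⟧) (deg D xs)
  = begin
    (a + (b + s)) * 2        ≡⟨ lemma₁ a b s ⟩
    (a + b) * 2 + s * 2      ≡⟨ cong₂ (λ p q → p * 2 + q) a+b (sum-deg D u) ⟩
    n * 2 + n * (n ∸ 1)      ≡⟨ lemma₂ n ⟩
    n + n * n                ∎
  where
  open ≡-Reasoning
  n = length xs
  a = sumOver xs (⟦_⟧ ∘ beats D x)
  b = sumOver xs (λ y → ⟦ beats D y x ⟧)
  s = sumOver xs (deg D xs)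
  lemma₁ : ∀ a b s → (a + (b + s)) * 2 ≡ (a + b) * 2 + s * 2
  lemma₁ = solve-∀
  lemma₂ : ∀ n → n * 2 + n * (n ∸ 1) ≡ n + n * n
  lemma₂ zero = refl
  lemma₂ (suc n) = eq n
    where
    eq : ∀ n → suc n * 2 + suc n * n ≡ suc n + suc n * suc n
    eq = solve-∀
  one : ∀ {y} → y ∈ xs → ⟦ beats D x y ⟧ + ⟦ beats D y x ⟧ ≡ 1
  one {y} y∈ rewrite total D (All.lookup x≢ y∈) with beats D y x
  ... | true = refl
  ... | false = refl
  a+b : a + b ≡ n
  a+b = trans (sym (sumOver-+ xs _ _)) (trans (sumOver-cong xs one) (trans (sumOver-const xs 1) (*-identityʳ n)))

-- Stars

position : ℕ → List ℕ → ℕ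
position x [] = 0
position x (y ∷ ys) with x ≟ y
... | yes _ = 0
... | no _ = suc (position x ys)

-- 0 beyond the end of the list.
nth : List ℕ → ℕ → ℕ
nth [] _ = 0
nth (x ∷ xs) zero = x
nth (x ∷ xs) (suc i) = nth xs i

position-< : ∀ {x xs} → x ∈ xs → position x xs < length xs
position-< {x} {y ∷ ys} x∈ with x ≟ y | x∈
... | yes _  | _ = z<s
... | no x≢y | here x≡y = contradiction x≡y x≢y
... | no _   | there x∈ys = s<s (position-< x∈ys)

nth-position : ∀ {x xs} → x ∈ xs → nth xs (position x xs) ≡ x
nth-position {x} {y ∷ ys} x∈ with x ≟ y | x∈
... | yes x≡y | _ = sym x≡y
... | no x≢y  | here x≡y = contradiction x≡y x≢y
... | no _    | there x∈ys = nth-position x∈ys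

nth-∈ : ∀ {xs i} → i < length xs → nth xs i ∈ xs
nth-∈ {x ∷ xs} {zero} _ = here refl
nth-∈ {x ∷ xs} {suc i} (s<s i<) = there (nth-∈ i<)

position-nth : ∀ {xs i} → Unique xs → i < length xs → position (nth xs i) xs ≡ i
position-nth {x ∷ xs} {zero} u _ with x ≟ x
... | yes _ = refl
... | no x≢x = contradiction refl x≢x
position-nth {x ∷ xs} {suc i} (x≢ ∷ u) (s<s i<) with nth xs i ≟ x
... | yes eq = contradiction (sym eq) (All.lookup x≢ (nth-∈ i<))
... | no _ = cong suc (position-nth u i<)

StarAdj : ℕ → List ℕ → Rel ℕ 0ℓ
StarAdj c ls x y = (x ≡ c × y ∈ ls) ⊎ (y ≡ c × x ∈ ls)

starAt : ∀ c ls → Unique (c ∷ ls) → Graph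
starAt c ls u = record
  { vertices = c ∷ ls
  ; unique   = u
  ; Adj      = StarAdj c ls
  ; adj?     = λ x y → ((x ≟ c) ×-dec (y ∈? ls)) ⊎-dec ((y ≟ c) ×-dec (x ∈? ls))
  ; adj-sym  = swap
  ; adj-irr  = λ { refl (inj₁ (refl , x∈)) → Unique[x∷xs]⇒x∉xs u x∈
                 ; refl (inj₂ (refl , x∈)) → Unique[x∷xs]⇒x∉xs u x∈ }
  ; adj-∈    = λ { (inj₁ (refl , _)) → here refl ; (inj₂ (_ , x∈)) → there x∈ }
  }

-- The centre heads the vertex list, so its position is 0, the centre of the standard star, and the
-- leaves take the positive positions.
starAt≅star : ∀ {c ls} (u : Unique (c ∷ ls)) → starAt c ls u ≅ star (length ls)
starAt≅star {c} {ls} u = record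
  { to       = λ x → position x (c ∷ ls)
  ; from     = nth (c ∷ ls)
  ; to-∈     = λ x∈ → ∈-upTo⁺ (position-< x∈)
  ; from-∈   = λ i∈ → nth-∈ {c ∷ ls} (∈-upTo⁻ i∈)
  ; from∘to  = nth-position
  ; to∘from  = λ i∈ → position-nth u (∈-upTo⁻ i∈)
  ; to-adj   = λ { (inj₁ (refl , y∈)) → inj₁ (centre , 0<leaf y∈ , position-< (there y∈))
                 ; (inj₂ (refl , x∈)) → inj₂ (centre , 0<leaf x∈ , position-< (there x∈)) }
  ; from-adj = λ { (inj₁ (refl , z<s , y<)) → inj₁ (refl , nth-∈ (s<s⁻¹ y<))
                 ; (inj₂ (refl , z<s , x<)) → inj₂ (refl , nth-∈ (s<s⁻¹ x<)) }
  }
  where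
  centre : position c (c ∷ ls) ≡ 0
  centre = position-nth {c ∷ ls} u z<s
  0<leaf : ∀ {y} → y ∈ ls → 0 < position y (c ∷ ls)
  0<leaf {y} y∈ with y ≟ c
  ... | yes refl = contradiction y∈ (Unique[x∷xs]⇒x∉xs u)
  ... | no _ = z<s

-- The middle of the path is 1 and the centre of the star is 0. Through this isomorphism every
-- `P_3`-design is handled as a design of stars with two edges.
path3≅star2 : path 3 ≅ star 2
path3≅star2 = record
  { to = swap01 ; from = swap01
  ; to-∈ = swap01-∈ ; from-∈ = swap01-∈
  ; from∘to = λ {x} _ → invol x ; to∘from = λ {x} _ → invol x
  ; to-adj = to-adj ; from-adj = from-adj }
  where
  swap01 : ℕ → ℕ
  swap01 0 = 1
  swap01 1 = 0
  swap01 x = x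
  invol : ∀ x → swap01 (swap01 x) ≡ x
  invol 0 = refl
  invol 1 = refl
  invol (suc (suc x)) = refl
  swap01-∈ : ∀ {x} → x ∈ upTo 3 → swap01 x ∈ upTo 3
  swap01-∈ (here refl) = there (here refl)
  swap01-∈ (there (here refl)) = here refl
  swap01-∈ (there (there p@(here refl))) = there (there p)
  to-adj : ∀ {x y} → Adj (path 3) x y → Adj (star 2) (swap01 x) (swap01 y)
  to-adj {0} (_ , _ , inj₁ refl) = inj₂ (refl , z<s , s<s z<s)
  to-adj {1} (_ , _ , inj₁ refl) = inj₁ (refl , z<s , s<s (s<s z<s))
  to-adj {suc (suc x)} (_ , s<s (s<s (s<s ())) , inj₁ refl)
  to-adj {y = 0} (_ , _ , inj₂ refl) = inj₁ (refl , z<s , s<s z<s)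
  to-adj {y = 1} (_ , _ , inj₂ refl) = inj₂ (refl , z<s , s<s (s<s z<s))
  to-adj {y = suc (suc y)} (s<s (s<s (s<s ())) , _ , inj₂ refl)
  spoke : ∀ {x y} → x ≡ 0 → 0 < y → y < 3 → Adj (path 3) (swap01 x) (swap01 y)
  spoke {y = 1} refl _ _ = s<s z<s , z<s , inj₂ refl
  spoke {y = 2} refl _ _ = s<s z<s , s<s (s<s z<s) , inj₁ refl
  spoke {y = suc (suc (suc y))} refl _ (s<s (s<s (s<s ())))
  from-adj : ∀ {x y} → Adj (star 2) x y → Adj (path 3) (swap01 x) (swap01 y)
  from-adj (inj₁ (x≡0 , 0<y , y<)) = spoke x≡0 0<y y<
  from-adj {x} {y} (inj₂ (y≡0 , 0<x , x<)) = adj-sym (path 3) {swap01 y} {swap01 x} (spoke y≡0 0<x x<)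

≅-sym : ∀ {G H} → G ≅ H → H ≅ G
≅-sym φ = record
  { to = from ; from = to ; to-∈ = from-∈ ; from-∈ = to-∈
  ; from∘to = to∘from ; to∘from = from∘to ; to-adj = from-adj ; from-adj = to-adj }
  where open _≅_ φ

≅-trans : ∀ {G H K} → G ≅ H → H ≅ K → G ≅ K
≅-trans φ ψ = record
  { to = ψ.to ∘ φ.to ; from = φ.from ∘ ψ.from
  ; to-∈ = ψ.to-∈ ∘ φ.to-∈ ; from-∈ = φ.from-∈ ∘ ψ.from-∈
  ; from∘to = λ x∈ → trans (cong φ.from (ψ.from∘to (φ.to-∈ x∈))) (φ.from∘to x∈)
  ; to∘from = λ y∈ → trans (cong ψ.to (φ.to∘from (ψ.from-∈ y∈))) (ψ.to∘from y∈)
  ; to-adj = ψ.to-adj ∘ φ.to-adj ; from-adj = φ.from-adj ∘ ψ.from-adj }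
  where
  module φ = _≅_ φ
  module ψ = _≅_ ψ

design-≅ : ∀ {K Γ Γ′} → Γ ≅ Γ′ → Design K Γ → Design K Γ′
design-≅ ψ 𝓑 = record
  { size = size 𝓑 ; block = block 𝓑 ; distinct = distinct 𝓑 ; block≤ = block≤ 𝓑
  ; block≅ = λ i → ≅-trans (block≅ 𝓑 i) ψ
  ; cover = cover 𝓑 ; disjoint = disjoint 𝓑 }

centre : ∀ {G k} → G ≅ star k → ℕ
centre φ = _≅_.from φ 0

leaves : ∀ {G k} → G ≅ star k → List ℕ
leaves {k = k} φ = map (_≅_.from φ) (applyUpTo suc k)

module _ {G : Graph} {k : ℕ} (φ : G ≅ star k) where
  open _≅_ φ

  private
    0∈ : 0 ∈ upTo (suc k)
    0∈ = here refl

    from-injective : ∀ {i j} → i ∈ upTo (suc k) → j ∈ upTo (suc k) → from i ≡ from j → i ≡ j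
    from-injective i∈ j∈ eq = trans (sym (to∘from i∈)) (trans (cong to eq) (to∘from j∈))

  length-leaves : length (leaves φ) ≡ k
  length-leaves = trans (length-map from (applyUpTo suc k)) (length-applyUpTo suc k)

  centre∷leaves-unique : Unique (centre φ ∷ leaves φ)
  centre∷leaves-unique = unique-map {f = from} {xs = upTo (suc k)} from-injective (upTo⁺ (suc k))

  centre-∈ : centre φ ∈ vertices G
  centre-∈ = from-∈ 0∈

  leaf-adj : ∀ {y} → y ∈ leaves φ → Adj G (centre φ) y
  leaf-adj y∈ with ∈-map⁻ from y∈
  ... | j , j∈ , refl with ∈-applyUpTo⁻ suc j∈
  ... | i , i<k , refl = from-adj (inj₁ (refl , z<s , s<s i<k))

  private
    to-centre : ∀ {z} → z ∈ vertices G → to z ≡ 0 → z ≡ centre φ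
    to-centre z∈ eq = trans (sym (from∘to z∈)) (cong from eq)

    to-leaf : ∀ {z} → z ∈ vertices G → 0 < to z → to z < suc k → z ∈ leaves φ
    to-leaf {z} z∈ 0< z< with to z in eq
    ... | suc j = subst (_∈ leaves φ) (trans (cong from (sym eq)) (from∘to z∈))
                    (∈-map⁺ from (∈-applyUpTo⁺ suc (s<s⁻¹ z<)))

  adj-leaf : ∀ {x y} → Adj G x y → StarAdj (centre φ) (leaves φ) x y
  adj-leaf a with adj-∈ G a | adj-∈ G (adj-sym G a) | to-adj a
  ... | x∈ | y∈ | inj₁ (x↦0 , 0<y , y<) = inj₁ (to-centre x∈ x↦0 , to-leaf y∈ 0<y y<)
  ... | x∈ | y∈ | inj₂ (y↦0 , 0<x , x<) = inj₂ (to-centre y∈ y↦0 , to-leaf x∈ 0<x x<)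

-- Designs from tournaments

lookup-related : ∀ {A : Set} {R : Rel A 0ℓ} {xs} → Symmetric R → AllPairs R xs →
                 ∀ {i j} → i ≢ j → R (lookup xs i) (lookup xs j)
lookup-related s (r ∷ rs) {zero} {zero} i≢j = contradiction refl i≢j
lookup-related s (r ∷ rs) {zero} {suc j} _ = All.lookup r (∈-lookup j)
lookup-related s (r ∷ rs) {suc i} {zero} _ = s (All.lookup r (∈-lookup i))
lookup-related s (r ∷ rs) {suc i} {suc j} i≢j = lookup-related s rs (i≢j ∘ cong suc)

unique-++⁻ : ∀ {A : Set} (xs : List A) {ys} → Unique (xs ++ ys) → Unique xs × Unique ys × Disjoint xs ys
unique-++⁻ [] u = [] , u , λ ()
unique-++⁻ (x ∷ xs) (x≢ ∷ u) with unique-++⁻ xs u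
... | uxs , uys , dis = All.++⁻ˡ xs x≢ ∷ uxs , uys ,
  λ { (here refl , z∈ys) → All.lookup (All.++⁻ʳ xs x≢) z∈ys refl
    ; (there z∈xs , z∈ys) → dis (z∈xs , z∈ys) }

unique-concat⁻ : ∀ {A : Set} (xss : List (List A)) → Unique (concat xss) →
                 All Unique xss × AllPairs Disjoint xss
unique-concat⁻ [] u = [] , []
unique-concat⁻ (xs ∷ xss) u with unique-++⁻ xs u
... | uxs , uxss , dis with unique-concat⁻ xss uxss
... | us , ds = uxs ∷ us , All.tabulate (λ ys∈ (z∈xs , z∈ys) → dis (z∈xs , ∈-concat⁺′ z∈ys ys∈)) ∷ ds

-- Each out-neighbourhood of D within V is split into k-sets, which become the
-- leaf sets of the stars centred at that vertex.
record Splitting (V : List ℕ) (D : Tournament) (k : ℕ) : Set where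
  field
    groups   : ℕ → List (List ℕ)
    length-≡ : ∀ {c g} → c ∈ V → g ∈ groups c → length g ≡ k
    groups-unique : ∀ c → Unique (concat (groups c))
    sound    : ∀ {c y} → y ∈ concat (groups c) → y ∈ V × beats D c y ≡ true
    exhaustive : ∀ {c y} → c ∈ V → y ∈ V → beats D c y ≡ true → y ∈ concat (groups c)

module _ {V : List ℕ} (u : Unique V) {D : Tournament} {k : ℕ} (0<k : 0 < k) (S : Splitting V D k) where
  open Splitting S

  private
    stars : List (ℕ × List ℕ)
    stars = labelled id groups V

    ∈-stars⁻ : ∀ {c g} → (c , g) ∈ stars → c ∈ V × g ∈ groups c
    ∈-stars⁻ t∈ with ∈-labelled⁻ id groups {xs = V} t∈
    ... | c , c∈ , refl , g∈ = c∈ , g∈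

    -- Stars in this relation share no arc. If their centres differ, a common edge would join the
    -- two centres and be directed both ways, which `D` excludes.
    Apart : Rel (ℕ × List ℕ) 0ℓ
    Apart (c , g) (c′ , g′) = c ≢ c′ ⊎ Disjoint g g′

    apart-sym : Symmetric Apart
    apart-sym (inj₁ c≢) = inj₁ (c≢ ∘ sym)
    apart-sym (inj₂ dis) = inj₂ (dis ∘ λ (p , q) → q , p)

    stars-apart : AllPairs Apart stars
    stars-apart = AllPairs.concat⁺
      (All.map⁺ (All.tabulate λ {c} _ → AllPairs.map⁺ (AllPairs.map inj₂ (proj₂ (unique-concat⁻ (groups c) (groups-unique c))))))
      (AllPairs.map⁺ (AllPairs.map (λ c≢ → All.map⁺ (All.tabulate λ _ → All.map⁺ (All.tabulate λ _ → inj₁ c≢))) u))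

    group-sound : ∀ {c g y} → g ∈ groups c → y ∈ g → y ∈ V × beats D c y ≡ true
    group-sound g∈ y∈ = sound (∈-concat⁺′ y∈ g∈)

    star-unique : ∀ {c g} → g ∈ groups c → Unique (c ∷ g)
    star-unique {c} g∈ =
      All.tabulate (λ y∈ → beats⇒≢ D (proj₂ (group-sound g∈ y∈)))
      ∷ All.lookup (proj₁ (unique-concat⁻ (groups c) (groups-unique c))) g∈

    module Star (i : Fin (length stars)) where
      mid : ℕ
      mid = proj₁ (lookup stars i)
      ends : List ℕ
      ends = proj₂ (lookup stars i)
      mid∈ : mid ∈ V
      mid∈ = proj₁ (∈-stars⁻ (∈-lookup i))
      ends∈ : ends ∈ groups mid
      ends∈ = proj₂ (∈-stars⁻ (∈-lookup i))
      graph : Graph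
      graph = starAt mid ends (star-unique ends∈)
    open Star

    -- The centre beats all its leaves, so the direction of an edge in `D` reveals which endpoint is
    -- the centre.
    adj-mid : ∀ i {x y} → StarAdj (mid i) (ends i) x y → beats D x y ≡ true → x ≡ mid i × y ∈ ends i
    adj-mid i (inj₁ a) _ = a
    adj-mid i (inj₂ (refl , x∈)) b
      with () ← trans (sym b) (beats-asym D (proj₂ (group-sound (ends∈ i) x∈)))

    same-star : ∀ i j {y} → mid i ≡ mid j → y ∈ ends i → y ∈ ends j → i ≡ j
    same-star i j eq y∈i y∈j with i Fin.≟ j
    ... | yes i≡j = i≡j
    ... | no i≢j with lookup-related apart-sym stars-apart i≢j
    ... | inj₁ mid≢ = contradiction eq mid≢
    ... | inj₂ dis = ⊥-elim (dis (y∈i , y∈j))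

    disj : ∀ i j {x y} → StarAdj (mid i) (ends i) x y → StarAdj (mid j) (ends j) x y → i ≡ j
    disj i j {x} {y} a b with beats-total D (λ { refl → adj-irr (graph i) refl a })
    ... | inj₁ xy with adj-mid i a xy | adj-mid j b xy
    ... | refl , y∈i | x≡ , y∈j = same-star i j x≡ y∈i y∈j
    disj i j {x} {y} a b | inj₂ yx with adj-mid i (swap a) yx | adj-mid j (swap b) yx
    ... | refl , x∈i | y≡ , x∈j = same-star i j y≡ x∈i x∈j

    leaf-exists : ∀ i → ∃ λ y → y ∈ ends i
    leaf-exists i = _ , nth-∈ {ends i} {0} (subst (0 <_) (sym (length-≡ (mid∈ i) (ends∈ i))) 0<k)

    starIndex : ∀ {c g} → c ∈ V → g ∈ groups c → ∃ λ i → (c , g) ≡ lookup stars i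
    starIndex c∈ g∈ = index (∈-labelled⁺ id groups c∈ g∈) , lookup-index (∈-labelled⁺ id groups c∈ g∈)

    edge-covered : ∀ {x y} → x ∈ V → y ∈ V → beats D x y ≡ true →
                   ∃ λ i → x ≡ mid i × y ∈ ends i
    edge-covered {x} x∈ y∈ b with ∈-concat⁻′ (groups x) (exhaustive x∈ y∈ b)
    ... | g , y∈g , g∈ with starIndex x∈ g∈
    ... | i , eq = i , cong proj₁ eq , subst (_ ∈_) (cong proj₂ eq) y∈g

  starDesign : Design (complete V u) (star k)
  starDesign = record
    { size     = length stars
    ; block    = graph
    -- Since `0 < k`, each star has a leaf; equal blocks therefore share an edge, and `disj`
    -- identifies their indices.
    ; distinct = λ {i} {j} (_ , _ , j⊆i) → let y , y∈ = leaf-exists j in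
                 disj i j (j⊆i (inj₁ (refl , y∈))) (inj₁ (refl , y∈))
    ; block≤   = λ i → (λ { (here refl) → mid∈ i ; (there y∈) → proj₁ (group-sound (ends∈ i) y∈) })
               , λ { (inj₁ (refl , y∈)) → let y∈V , b = group-sound (ends∈ i) y∈ in mid∈ i , y∈V , beats⇒≢ D b
                   ; (inj₂ (refl , x∈)) → let x∈V , b = group-sound (ends∈ i) x∈ in x∈V , mid∈ i , beats⇒≢ D b ∘ sym }
    ; block≅   = λ i → subst (λ m → graph i ≅ star m) (length-≡ (mid∈ i) (ends∈ i)) (starAt≅star (star-unique (ends∈ i)))
    ; cover    = λ (x∈ , y∈ , x≢y) → case beats-total D x≢y of λ
        { (inj₁ b) → let i , a = edge-covered x∈ y∈ b in i , inj₁ a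
        ; (inj₂ b) → let i , a = edge-covered y∈ x∈ b in i , inj₂ a }
    ; disjoint = λ {i} {j} → disj i j
    }

  starDesign-block : ∀ {c g} → c ∈ V → g ∈ groups c →
                     ∃ λ i → ∃ λ v → block starDesign i ≡ starAt c g v
  starDesign-block c∈ g∈ = let i , eq = starIndex c∈ g∈ in i , helper i eq
    where
    helper : ∀ {c g} i → (c , g) ≡ lookup stars i → ∃ λ v → block starDesign i ≡ starAt c g v
    helper i refl = star-unique (ends∈ i) , refl

-- The number of chunks is prescribed, which makes the recursion structural. Elements after the
-- first `m * k` are dropped, so inclusion and uniqueness hold for every list, while chunk lengths
-- and completeness need `length xs ≡ m * k`.
chunks : ∀ {A : Set} → ℕ → ℕ → List A → List (List A)
chunks zero k xs = []
chunks (suc m) k xs = take k xs ∷ chunks m k (drop k xs)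

take-+ : ∀ {A : Set} m n (xs : List A) → take m xs ++ take n (drop m xs) ≡ take (m + n) xs
take-+ zero n xs = refl
take-+ (suc m) n [] = take-[] n
take-+ (suc m) n (x ∷ xs) = cong (x ∷_) (take-+ m n xs)

concat-chunks : ∀ {A : Set} m k (xs : List A) → concat (chunks m k xs) ≡ take (m * k) xs
concat-chunks zero k xs = refl
concat-chunks (suc m) k xs = trans (cong (take k xs ++_) (concat-chunks m k (drop k xs))) (take-+ k (m * k) xs)

length-chunks : ∀ {A : Set} m k (xs : List A) → length xs ≡ m * k → ∀ {g} → g ∈ chunks m k xs → length g ≡ k
length-chunks (suc m) k xs eq (here refl) =
  trans (length-take k xs) (trans (cong (k ⊓_) eq) (m≤n⇒m⊓n≡m (m≤m+n k (m * k))))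
length-chunks (suc m) k xs eq (there g∈) =
  length-chunks m k (drop k xs) (trans (length-drop k xs) (trans (cong (_∸ k) eq) (m+n∸m≡n k (m * k)))) g∈

chunks-complete : ∀ {A : Set} m k (xs : List A) → length xs ≡ m * k → concat (chunks m k xs) ≡ xs
chunks-complete m k xs eq = trans (concat-chunks m k xs) (take-all (m * k) xs (≤-reflexive eq))

chunks-⊆ : ∀ {A : Set} m k (xs : List A) → concat (chunks m k xs) ⊆ xs
chunks-⊆ m k xs z∈ = subst (_ ∈_) (take++drop≡id (m * k) xs) (∈-++⁺ˡ (subst (_ ∈_) (concat-chunks m k xs) z∈))

chunks-unique : ∀ {A : Set} m k {xs : List A} → Unique xs → Unique (concat (chunks m k xs))
chunks-unique m k {xs} u = subst Unique (sym (concat-chunks m k xs)) (take⁺ (m * k) u)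

-- Tournaments with two scores

-- Reversal of a symmetric edge set as an xor: both directions of a pair change together, so the
-- result is again a tournament, and the parities of out-degrees become additive.
flipEdges : (D : Tournament) (A : ℕ → ℕ → Bool) → (∀ x y → A x y ≡ A y x) → (∀ x → A x x ≡ false) → Tournament
flipEdges D A A-sym A-irr = record
  { beats  = λ x y → beats D x y xor A x y
  ; irrefl = λ x → cong₂ _xor_ (irrefl D x) (A-irr x)
  ; total  = λ {x} {y} x≢y → trans (cong₂ _xor_ (total D x≢y) (A-sym x y)) (sym (not-distribˡ-xor (beats D y x) (A y x)))
  }

edge : ℕ → ℕ → ℕ → ℕ → Bool
edge x y z w = (δ x z ∧ δ y w) ∨ (δ y z ∧ δ x w)

edge-sym : ∀ x y z w → edge x y z w ≡ edge x y w z
edge-sym x y z w rewrite ∧-comm (δ x w) (δ y z) | ∧-comm (δ y w) (δ x z) = ∨-comm (δ x z ∧ δ y w) (δ y z ∧ δ x w)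

edge-irrefl : ∀ {x y} → x ≢ y → ∀ z → edge x y z z ≡ false
edge-irrefl {x} {y} x≢y z with x ≟ z
... | no x≢z rewrite δ-≢ x≢z = ∧-zeroʳ (δ y z)
... | yes refl rewrite δ-refl x | δ-≢ (x≢y ∘ sym) = refl

-- One unit of out-degree passes from x to y; both sides are moved so that no
-- truncated subtraction occurs.
Moves : List ℕ → ℕ → ℕ → Tournament → Tournament → Set
Moves V x y D D′ = ∀ z → deg D′ V z + ⟦ δ x z ⟧ ≡ deg D V z + ⟦ δ y z ⟧

-- The last component allows `move-unit` to reverse two consecutive arcs: the second one avoids `x`
-- and is still present after the first reversal.
reverse-arc : ∀ {V} → Unique V → (D : Tournament) → ∀ {x y} → x ∈ V → y ∈ V → beats D x y ≡ true →
              ∃ λ D′ → Moves V x y D D′ × (∀ z w → z ≢ x → w ≢ x → beats D′ z w ≡ beats D z w)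
reverse-arc {V} u D {x} {y} x∈ y∈ b = D′ , moves , same
  where
  x≢y = beats⇒≢ D b
  D′ = flipEdges D (edge x y) (edge-sym x y) (edge-irrefl x≢y)

  same : ∀ z w → z ≢ x → w ≢ x → beats D′ z w ≡ beats D z w
  same z w z≢x w≢x rewrite δ-≢ (z≢x ∘ sym) | δ-≢ (w≢x ∘ sym) | ∧-zeroʳ (δ y z) = xor-identityʳ (beats D z w)

  -- The balance already holds entry by entry: only the pair `(x , y)` loses a unit and only
  -- `(y , x)` gains one. Summing over `w` gives `moves`.
  pointwise : ∀ z w → ⟦ beats D′ z w ⟧ + ⟦ δ x z ⟧ * ⟦ δ y w ⟧ ≡ ⟦ beats D z w ⟧ + ⟦ δ y z ⟧ * ⟦ δ x w ⟧
  pointwise z w with δ x z in xz | δ y w in yw | δ y z in yz | δ x w in xw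
  ... | true | true | true | _ with refl ← δ-true {x} xz | refl ← δ-true {y} yz = contradiction refl x≢y
  ... | true | true | false | _ with refl ← δ-true {x} xz | refl ← δ-true {y} yw rewrite b = refl
  ... | true | false | true | _ with refl ← δ-true {x} xz | refl ← δ-true {y} yz = contradiction refl x≢y
  ... | true | false | false | _ rewrite xor-identityʳ (beats D z w) = refl
  ... | false | _ | true | true with refl ← δ-true {y} yz | refl ← δ-true {x} xw rewrite beats-asym D b = refl
  ... | false | _ | true | false rewrite xor-identityʳ (beats D z w) = refl
  ... | false | _ | false | _ rewrite xor-identityʳ (beats D z w) = refl

  Σδ : ∀ c {t} → t ∈ V → sumOver V (λ w → c * ⟦ δ t w ⟧) ≡ c
  Σδ c t∈ = trans (sumOver-*ˡ V c _) (trans (cong (c *_) (sumOver-δ u t∈)) (*-identityʳ c))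

  moves : Moves V x y D D′
  moves z = begin
    deg D′ V z + ⟦ δ x z ⟧                                            ≡⟨ cong (deg D′ V z +_) (Σδ ⟦ δ x z ⟧ y∈) ⟨
    deg D′ V z + sumOver V (λ w → ⟦ δ x z ⟧ * ⟦ δ y w ⟧)              ≡⟨ sumOver-+ V _ _ ⟨
    sumOver V (λ w → ⟦ beats D′ z w ⟧ + ⟦ δ x z ⟧ * ⟦ δ y w ⟧)        ≡⟨ sumOver-cong V (λ {w} _ → pointwise z w) ⟩
    sumOver V (λ w → ⟦ beats D z w ⟧ + ⟦ δ y z ⟧ * ⟦ δ x w ⟧)         ≡⟨ sumOver-+ V _ _ ⟩
    deg D V z + sumOver V (λ w → ⟦ δ y z ⟧ * ⟦ δ x w ⟧)               ≡⟨ cong (deg D V z +_) (Σδ ⟦ δ y z ⟧ x∈) ⟩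
    deg D V z + ⟦ δ y z ⟧                                             ∎
    where open ≡-Reasoning

-- If deg x ≥ deg y then there is a path of length at most 2 from x to y; reverse it.
move-unit : ∀ {V} → Unique V → (D : Tournament) → ∀ {x y} → x ∈ V → y ∈ V → x ≢ y →
            deg D V y ≤ deg D V x → ∃ (Moves V x y D)
move-unit {V} u D {x} {y} x∈ y∈ x≢y y≤x with beats-total D x≢y
... | inj₁ xy = let D′ , m , _ = reverse-arc u D x∈ y∈ xy in D′ , m
... | inj₂ yx with Any.any? (λ z → (beats D x z Bool.≟ true) ×-dec (beats D z y Bool.≟ true)) V
-- Without a two-step path, `y` beats everything that `x` beats, and `y` beats `x` as well; hence
-- its out-degree would be strictly larger.
... | no none = contradiction y≤x (<⇒≱ (sumOver-mono-< V below x∈ strict))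
  where
  strict : ⟦ beats D x x ⟧ < ⟦ beats D y x ⟧
  strict rewrite irrefl D x | yx = z<s
  below : ∀ {z} → z ∈ V → ⟦ beats D x z ⟧ ≤ ⟦ beats D y z ⟧
  below {z} z∈ with beats D x z in xz
  ... | false = z≤n
  ... | true with z ≟ y
  ... | yes refl with () ← trans (sym xz) (beats-asym D yx)
  below {z} z∈ | true | no z≢y with beats-total D z≢y
  ... | inj₁ zy = contradiction (lose z∈ (xz , zy)) none
  ... | inj₂ yz rewrite yz = s≤s z≤n
move-unit {V} u D {x} {y} x∈ y∈ x≢y y≤x | inj₂ yx | yes found with find found
... | z , z∈ , xz , zy with reverse-arc u D x∈ z∈ xz
... | D′ , m , same with reverse-arc u D′ z∈ y∈ (trans (same z y (beats⇒≢ D xz ∘ sym) (x≢y ∘ sym)) zy)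
-- Adding the transfers from `x` to `z` and from `z` to `y` cancels the unit at `z` and the degrees
-- in `D′`.
... | D″ , m′ , _ = D″ , λ w → +-cancelˡ-≡ (deg D′ V w + ⟦ δ z w ⟧) _ _ (begin
    deg D′ V w + ⟦ δ z w ⟧ + (deg D″ V w + ⟦ δ x w ⟧) ≡⟨ shuffle (deg D′ V w) ⟦ δ z w ⟧ (deg D″ V w) ⟦ δ x w ⟧ ⟩
    deg D″ V w + ⟦ δ z w ⟧ + (deg D′ V w + ⟦ δ x w ⟧) ≡⟨ cong₂ _+_ (m′ w) (m w) ⟩
    deg D′ V w + ⟦ δ y w ⟧ + (deg D V w + ⟦ δ z w ⟧)  ≡⟨ shuffle′ (deg D′ V w) ⟦ δ y w ⟧ (deg D V w) ⟦ δ z w ⟧ ⟩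
    deg D′ V w + ⟦ δ z w ⟧ + (deg D V w + ⟦ δ y w ⟧)  ∎)
  where
  open ≡-Reasoning
  shuffle : ∀ a b c d → a + b + (c + d) ≡ c + b + (a + d)
  shuffle = solve-∀
  shuffle′ : ∀ a b c d → a + b + (c + d) ≡ a + d + (c + b)
  shuffle′ = solve-∀

-- Surplus vertices only occur at the largest target value c, so their
-- out-degree exceeds that of every deficient vertex and move-unit applies.
lower-surplus : ∀ {V S} → Unique V → Unique S → S ⊆ V → (t : ℕ → ℕ) (c : ℕ) →
  (∀ {x} → x ∈ S → t x ≤ c) →
  ∀ N (D : Tournament) → sumOver S (λ x → deg D V x ∸ t x) ≤ N →
  sumOver S (deg D V) ≤ sumOver S t →
  (∀ {x} → x ∈ S → deg D V x ≤ t x ⊎ c ≤ t x) →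
  ∃ λ D′ → ∀ {x} → x ∈ S → deg D′ V x ≤ t x
lower-surplus {V} {S} u uS S⊆V t c t≤c N D N≥ Σ≤ high with Any.any? (λ x → t x <? deg D V x) S
... | no none = D , λ x∈ → ≮⇒≥ (λ lt → none (lose x∈ lt))
... | yes some with find some
... | x , x∈ , tx< with Any.any? (λ y → deg D V y <? t y) S
-- With one vertex above its target and none below, the out-degrees would have a larger sum than the
-- targets.
... | no none = contradiction Σ≤ (<⇒≱ (sumOver-mono-< S (λ y∈ → ≮⇒≥ (λ lt → none (lose y∈ lt))) x∈ tx<))
... | yes some′ with find some′
... | y , y∈ , <ty with move-unit u D (S⊆V x∈) (S⊆V y∈) (λ { refl → <-asym tx< <ty }) y≤x
  where
  y≤x : deg D V y ≤ deg D V x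
  y≤x with high x∈
  ... | inj₁ ≤t = contradiction ≤t (<⇒≱ tx<)
  ... | inj₂ c≤t = ≤-trans (<⇒≤ <ty) (≤-trans (t≤c y∈) (≤-trans c≤t (<⇒≤ tx<)))
... | D′ , m = continue N N≥
  where
  x≢y : x ≢ y
  x≢y refl = <-asym tx< <ty

  Σ-same : sumOver S (deg D′ V) ≡ sumOver S (deg D V)
  Σ-same = +-cancelʳ-≡ 1 _ _ (begin
    sumOver S (deg D′ V) + 1                            ≡⟨ cong (sumOver S (deg D′ V) +_) (sumOver-δ uS x∈) ⟨
    sumOver S (deg D′ V) + sumOver S (λ z → ⟦ δ x z ⟧)  ≡⟨ sumOver-+ S _ _ ⟨
    sumOver S (λ z → deg D′ V z + ⟦ δ x z ⟧)            ≡⟨ sumOver-cong S (λ {z} _ → m z) ⟩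
    sumOver S (λ z → deg D V z + ⟦ δ y z ⟧)             ≡⟨ sumOver-+ S _ _ ⟩
    sumOver S (deg D V) + sumOver S (λ z → ⟦ δ y z ⟧)   ≡⟨ cong (sumOver S (deg D V) +_) (sumOver-δ uS y∈) ⟩
    sumOver S (deg D V) + 1                             ∎)
    where open ≡-Reasoning

  change : ∀ z → (z ≡ x × suc (deg D′ V z) ≡ deg D V z)
               ⊎ (z ≡ y × deg D′ V z ≡ suc (deg D V z))
               ⊎ deg D′ V z ≡ deg D V z
  change z with x ≟ z | y ≟ z | m z
  ... | yes refl | yes refl | _ = contradiction refl x≢y
  ... | yes refl | no y≢x | eq rewrite δ-refl x | δ-≢ y≢x =
    inj₁ (refl , trans (+-comm 1 _) (trans eq (+-identityʳ _)))
  ... | no x≢z | yes refl | eq rewrite δ-refl y | δ-≢ x≢z =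
    inj₂ (inj₁ (refl , trans (sym (+-identityʳ _)) (trans eq (+-comm _ 1))))
  ... | no x≢z | no y≢z | eq rewrite δ-≢ x≢z | δ-≢ y≢z =
    inj₂ (inj₂ (trans (sym (+-identityʳ _)) (trans eq (+-identityʳ _))))

  high′ : ∀ {z} → z ∈ S → deg D′ V z ≤ t z ⊎ c ≤ t z
  high′ {z} z∈ with high z∈ | change z
  ... | inj₂ c≤ | _ = inj₂ c≤
  ... | inj₁ ≤t | inj₁ (_ , eq) = inj₁ (≤-trans (n≤1+n _) (≤-trans (≤-reflexive eq) ≤t))
  ... | inj₁ ≤t | inj₂ (inj₁ (refl , eq)) = inj₁ (≤-trans (≤-reflexive eq) <ty)
  ... | inj₁ ≤t | inj₂ (inj₂ eq) = inj₁ (≤-trans (≤-reflexive eq) ≤t)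

  no-more : ∀ z → deg D′ V z ∸ t z ≤ deg D V z ∸ t z
  no-more z with change z
  ... | inj₁ (_ , eq) = ∸-monoˡ-≤ (t z) (≤-trans (n≤1+n _) (≤-reflexive eq))
  ... | inj₂ (inj₁ (refl , eq)) = ≤-trans (≤-reflexive (m≤n⇒m∸n≡0 (≤-trans (≤-reflexive eq) <ty))) z≤n
  ... | inj₂ (inj₂ eq) = ≤-reflexive (cong (_∸ t z) eq)

  x-less : deg D′ V x ∸ t x < deg D V x ∸ t x
  x-less with m x
  ... | eq rewrite δ-refl x | δ-≢ (x≢y ∘ sym) =
    ∸-monoˡ-< (≤-reflexive x-deg) (s≤s⁻¹ (≤-trans tx< (≤-reflexive (sym x-deg))))
    where
    x-deg : suc (deg D′ V x) ≡ deg D V x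
    x-deg = trans (+-comm 1 _) (trans eq (+-identityʳ _))

  decrease : sumOver S (λ z → deg D′ V z ∸ t z) < sumOver S (λ z → deg D V z ∸ t z)
  decrease = sumOver-mono-< S (λ {z} _ → no-more z) x∈ x-less

  -- `N` bounds the total surplus, which the transfer has strictly decreased; so `N` cannot be zero,
  -- and the recursion is structural in it.
  continue : ∀ N → sumOver S (λ z → deg D V z ∸ t z) ≤ N → ∃ λ D′ → ∀ {x} → x ∈ S → deg D′ V x ≤ t x
  continue zero N≥ = contradiction (≤-trans decrease N≥) λ ()
  continue (suc N) N≥ = lower-surplus u uS S⊆V t c t≤c N D′ (s≤s⁻¹ (≤-trans decrease N≥))
    (≤-trans (≤-reflexive Σ-same) Σ≤) high′

-- The transitive tournament in which larger numbers win. In it no arc leaves an initial segment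
-- such as `low`.
natOrder : Tournament
natOrder = record
  { beats  = λ x y → does (y <? x)
  ; irrefl = λ x → dec-false (x <? x) (<-irrefl refl)
  ; total  = λ {x} {y} → comparable x y
  }
  where
  comparable : ∀ x y → x ≢ y → does (y <? x) ≡ not (does (x <? y))
  comparable x y x≢y with <-cmp x y
  ... | tri< x<y _ y≮x = trans (dec-false (y <? x) y≮x) (cong not (sym (dec-true (x <? y) x<y)))
  ... | tri≈ _ x≡y _ = contradiction x≡y x≢y
  ... | tri> x≮y _ y<x = trans (dec-true (y <? x) y<x) (cong not (sym (dec-false (x <? y) x≮y)))

outs : Tournament → List ℕ → ℕ → List ℕ
outs D V c = filter (λ y → beats D c y Bool.≟ true) V

length-outs : ∀ D V c → length (outs D V c) ≡ deg D V c
length-outs D V c = length-filter-true (beats D c) V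

-- The aim is a tournament with `m` scores equal to `a` and `h` equal to `b`. The two equations on
-- sums, doubled to avoid halves, are Landau's conditions for the whole vertex set and for the set
-- of low scores.
module TwoScores (m h a b : ℕ) (a≤b : a ≤ b)
  (total-sum : (m * a + h * b) * 2 ≡ (m + h) * (m + h ∸ 1))
  (low-sum : m * (m ∸ 1) ≤ m * a * 2) where

  low high vertexList : List ℕ
  low = upTo m
  high = applyUpTo (m +_) h
  vertexList = low ++ high

  high-≥ : ∀ {x} → x ∈ high → m ≤ x
  high-≥ x∈ with ∈-applyUpTo⁻ (m +_) x∈
  ... | i , _ , refl = m≤m+n m i

  score : ℕ → ℕ
  score x = if does (x <? m) then a else b

  score-low : ∀ {x} → x ∈ low → score x ≡ a
  score-low x∈ = cong (if_then a else b) (dec-true (_ <? m) (∈-upTo⁻ x∈))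

  score-high : ∀ {x} → x ∈ high → score x ≡ b
  score-high x∈ = cong (if_then a else b) (dec-false (_ <? m) (≤⇒≯ (high-≥ x∈)))

  unique-low : Unique low
  unique-low = upTo⁺ m

  unique-vertexList : Unique vertexList
  unique-vertexList = ++⁺ unique-low
    (applyUpTo⁺₁ (m +_) h (λ i<j _ eq → <⇒≢ i<j (+-cancelˡ-≡ m _ _ eq)))
    (λ (x∈low , x∈high) → <⇒≱ (∈-upTo⁻ x∈low) (high-≥ x∈high))

  length-vertexList : length vertexList ≡ m + h
  length-vertexList = trans (length-++ low) (cong₂ _+_ (length-upTo m) (length-applyUpTo (m +_) h))

  -- All arcs out of `low` stay inside `low`, so the out-degrees there add up to m(m - 1)/2, which
  -- `low-sum` bounds.
  sum-low : sumOver low (deg natOrder vertexList) ≤ sumOver low (λ _ → a)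
  sum-low = *-cancelʳ-≤ _ _ 2 (begin
    sumOver low (deg natOrder vertexList) * 2  ≡⟨ cong (_* 2) (sumOver-cong low low-deg) ⟩
    sumOver low (deg natOrder low) * 2         ≡⟨ sum-deg natOrder unique-low ⟩
    length low * (length low ∸ 1)              ≡⟨ cong (λ n → n * (n ∸ 1)) (length-upTo m) ⟩
    m * (m ∸ 1)                                ≤⟨ low-sum ⟩
    m * a * 2                                  ≡⟨ cong (λ n → n * a * 2) (length-upTo m) ⟨
    length low * a * 2                         ≡⟨ cong (_* 2) (sumOver-const low a) ⟨
    sumOver low (λ _ → a) * 2                  ∎)
    where
    open ≤-Reasoning
    low-deg : ∀ {x} → x ∈ low → deg natOrder vertexList x ≡ deg natOrder low x
    low-deg {x} x∈ = trans (sumOver-++ low high _)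
      (trans (cong (deg natOrder low x +_) (sumOver-zero high λ {y} y∈ →
        cong ⟦_⟧ (dec-false (y <? x) (≤⇒≯ (≤-trans (<⇒≤ (∈-upTo⁻ x∈)) (high-≥ y∈))))))
      (+-identityʳ _))

  sum-score : sumOver vertexList score ≡ m * a + h * b
  sum-score = trans (sumOver-++ low high score) (cong₂ _+_
    (trans (sumOver-cong low score-low) (trans (sumOver-const low a) (cong (_* a) (length-upTo m))))
    (trans (sumOver-cong high score-high) (trans (sumOver-const high b) (cong (_* b) (length-applyUpTo (m +_) h)))))

  sum-vertexList : ∀ D → sumOver vertexList (deg D vertexList) ≡ sumOver vertexList score
  sum-vertexList D = *-cancelʳ-≡ _ _ 2 (begin
    sumOver vertexList (deg D vertexList) * 2  ≡⟨ sum-deg D unique-vertexList ⟩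
    length vertexList * (length vertexList ∸ 1) ≡⟨ cong (λ n → n * (n ∸ 1)) length-vertexList ⟩
    (m + h) * (m + h ∸ 1)                      ≡⟨ total-sum ⟨
    (m * a + h * b) * 2                        ≡⟨ cong (_* 2) sum-score ⟨
    sumOver vertexList score * 2               ∎)
    where open ≡-Reasoning

  -- Two rounds of `lower-surplus`. On `low` the target is constant, so surplus may start anywhere;
  -- afterwards only vertices of `high` can exceed their scores, as the second round requires. Upper
  -- bounds with the same total are equalities.
  tournament : ∃ λ D → ∀ {x} → x ∈ vertexList → deg D vertexList x ≡ score x
  tournament
    with lower-surplus unique-vertexList unique-low ∈-++⁺ˡ (λ _ → a) a (λ _ → ≤-refl)
           _ natOrder ≤-refl sum-low (λ _ → inj₂ ≤-refl)
  ... | D₁ , low≤a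
    with lower-surplus unique-vertexList unique-vertexList id score b
           (λ {x} x∈ → score≤b x∈) _ D₁ ≤-refl (≤-reflexive (sum-vertexList D₁)) bounded
    where
    score≤b : ∀ {x} → x ∈ vertexList → score x ≤ b
    score≤b x∈ with ∈-++⁻ low x∈
    ... | inj₁ x∈low = ≤-trans (≤-reflexive (score-low x∈low)) a≤b
    ... | inj₂ x∈high = ≤-reflexive (score-high x∈high)
    bounded : ∀ {x} → x ∈ vertexList → deg D₁ vertexList x ≤ score x ⊎ b ≤ score x
    bounded x∈ with ∈-++⁻ low x∈
    ... | inj₁ x∈low = inj₁ (≤-trans (low≤a x∈low) (≤-reflexive (sym (score-low x∈low))))
    ... | inj₂ x∈high = inj₂ (≤-reflexive (sym (score-high x∈high)))
  ... | D₂ , ≤score = D₂ , sumOver-mono-≡ vertexList ≤score (sum-vertexList D₂)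

-- Equality with a `starAt` pins down the centre without reference to an isomorphism.
HasStarAt : ∀ {K Γ} → Design K Γ → ℕ → Set₁
HasStarAt 𝓑 c = ∃ λ i → ∃₂ λ ls v → block 𝓑 i ≡ starAt c ls v

-- Both scores are multiples of `k`, so the out-neighbourhoods split into `q` leaf sets at low
-- vertices and `q + 1` at high ones. For `q = 0` only the high vertices are centres.
module TwoScoreDesign (k m h q : ℕ) (0<k : 0 < k)
  (total-sum : (m * (q * k) + h * (suc q * k)) * 2 ≡ (m + h) * (m + h ∸ 1))
  (low-sum : m * (m ∸ 1) ≤ m * (q * k) * 2) where

  open TwoScores m h (q * k) (suc q * k) (m≤n+m (q * k) k) total-sum low-sum public

  private
    D = proj₁ tournament

    count : ℕ → ℕ
    count x = if does (x <? m) then q else suc q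

    score≡ : ∀ x → score x ≡ count x * k
    score≡ x with does (x <? m)
    ... | true = refl
    ... | false = refl

    length-outs≡ : ∀ {c} → c ∈ vertexList → length (outs D vertexList c) ≡ count c * k
    length-outs≡ {c} c∈ = trans (length-outs D vertexList c) (trans (proj₂ tournament c∈) (score≡ c))

    splitting : Splitting vertexList D k
    splitting = record
      { groups        = λ c → chunks (count c) k (outs D vertexList c)
      ; length-≡      = λ {c} c∈ → length-chunks (count c) k (outs D vertexList c) (length-outs≡ c∈)
      ; groups-unique = λ c → chunks-unique (count c) k (filter⁺ _ unique-vertexList)
      ; sound         = λ {c} y∈ → ∈-filter⁻ _ {xs = vertexList} (chunks-⊆ (count c) k (outs D vertexList c) y∈)
      ; exhaustive    = λ {c} c∈ y∈ b → subst (_ ∈_)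
          (sym (chunks-complete (count c) k (outs D vertexList c) (length-outs≡ c∈))) (∈-filter⁺ _ y∈ b)
      }

  design : Design (complete vertexList unique-vertexList) (star k)
  design = starDesign unique-vertexList 0<k splitting

  star-at : ∀ {c} → c ∈ vertexList → 0 < count c → HasStarAt design c
  star-at {c} c∈ 0<count = let i , v , eq = starDesign-block unique-vertexList 0<k splitting c∈ (first (count c) 0<count)
                           in i , _ , v , eq
    where
    first : ∀ n {xs : List ℕ} → 0 < n → take k xs ∈ chunks n k xs
    first (suc n) _ = here refl

  star-at-high : ∀ {c} → c ∈ high → HasStarAt design c
  star-at-high {c} c∈ = star-at (∈-++⁺ʳ low c∈)
    (subst (λ b → 0 < (if b then q else suc q)) (sym (dec-false (c <? m) (≤⇒≯ (high-≥ c∈)))) z<s)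

  star-at-all : 0 < q → ∀ {c} → c ∈ vertexList → HasStarAt design c
  star-at-all 0<q {c} c∈ = star-at c∈ (positive (does (c <? m)))
    where
    positive : ∀ b → 0 < (if b then q else suc q)
    positive true = 0<q
    positive false = z<s

-- Counting edges and centres

module StarSystem {V : List ℕ} {u : Unique V} {k : ℕ} (𝓑 : Design (complete V u) (star k)) where

  mid : Fin (size 𝓑) → ℕ
  mid i = centre (block≅ 𝓑 i)

  ends : Fin (size 𝓑) → List ℕ
  ends i = leaves (block≅ 𝓑 i)

  mid∈V : ∀ i → mid i ∈ V
  mid∈V i = proj₁ (block≤ 𝓑 i) (centre-∈ (block≅ 𝓑 i))

  end-adj : ∀ {i y} → y ∈ ends i → Adj (block 𝓑 i) (mid i) y
  end-adj {i} = leaf-adj (block≅ 𝓑 i)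

  ends⊆V : ∀ {i} → ends i ⊆ V
  ends⊆V {i} y∈ = proj₁ (block≤ 𝓑 i) (adj-∈ (block 𝓑 i) (adj-sym (block 𝓑 i) (end-adj y∈)))

  mid∷ends-unique : ∀ i → Unique (mid i ∷ ends i)
  mid∷ends-unique i = centre∷leaves-unique (block≅ 𝓑 i)

  ends-unique : ∀ i → Unique (ends i)
  ends-unique i = AllPairs.tail (mid∷ends-unique i)

  mid≢end : ∀ {i y} → y ∈ ends i → mid i ≢ y
  mid≢end {i} = All.lookup (AllPairs.head (mid∷ends-unique i))

  length-ends : ∀ i → length (ends i) ≡ k
  length-ends i = length-leaves (block≅ 𝓑 i)

  same-arc : ∀ {i j y} → mid i ≡ mid j → y ∈ ends i → y ∈ ends j → i ≡ j
  same-arc eq y∈i y∈j = disjoint 𝓑 (end-adj y∈i) (subst (λ m → Adj (block 𝓑 _) m _) (sym eq) (end-adj y∈j))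

  opposite-arcs : ∀ {i j} → mid j ∈ ends i → ¬ mid i ∈ ends j
  opposite-arcs {i} {j} j∈i i∈j with disjoint 𝓑 (end-adj j∈i) (adj-sym (block 𝓑 j) (end-adj i∈j))
  ... | refl = mid≢end j∈i refl

  Out : ℕ → ℕ → Set
  Out x y = ∃ λ i → mid i ≡ x × y ∈ ends i

  out? : ∀ x y → Dec (Out x y)
  out? x y = Fin.any? λ i → (mid i ≟ x) ×-dec (y ∈? ends i)

  out-asym : ∀ {x y} → Out x y → ¬ Out y x
  out-asym (i , refl , y∈) (j , refl , x∈) = opposite-arcs y∈ x∈

  out-cover : ∀ {x y} → x ∈ V → y ∈ V → x ≢ y → Out x y ⊎ Out y x
  out-cover x∈ y∈ x≢y with cover 𝓑 (x∈ , y∈ , x≢y)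
  ... | i , a with adj-leaf (block≅ 𝓑 i) a
  ... | inj₁ (refl , y∈i) = inj₁ (i , refl , y∈i)
  ... | inj₂ (refl , x∈i) = inj₂ (i , refl , x∈i)

  -- Edges of blocks are directed away from the centre, other pairs upwards.
  abstract
    outwards : Tournament
    outwards = record
      { beats  = λ x y → does (out? x y) ∨ (not (does (out? y x)) ∧ does (x <? y))
      ; irrefl = irr
      ; total  = tot
      }
      where
      irr : ∀ x → does (out? x x) ∨ (not (does (out? x x)) ∧ does (x <? x)) ≡ false
      irr x rewrite dec-false (out? x x) (λ o → out-asym o o) = dec-false (x <? x) (<-irrefl refl)
      tot : ∀ {x y} → x ≢ y → does (out? x y) ∨ (not (does (out? y x)) ∧ does (x <? y))
                       ≡ not (does (out? y x) ∨ (not (does (out? x y)) ∧ does (y <? x)))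
      tot {x} {y} x≢y with out? x y | out? y x
      ... | yes xy | yes yx = contradiction yx (out-asym xy)
      ... | yes _ | no _ = refl
      ... | no _ | yes _ = refl
      ... | no _ | no _ = total natOrder (x≢y ∘ sym)

    out⇒beats : ∀ {x y} → Out x y → beats outwards x y ≡ true
    out⇒beats {x} {y} o rewrite dec-true (out? x y) o = refl

    beats⇒out : ∀ {x y} → x ∈ V → y ∈ V → beats outwards x y ≡ true → Out x y
    beats⇒out x∈ y∈ b with out-cover x∈ y∈ (beats⇒≢ outwards b)
    ... | inj₁ o = o
    ... | inj₂ o with () ← trans (sym b) (beats-asym outwards (out⇒beats o))

  -- The arcs of `outwards` on `V` are listed by block and again by tail. The first list has length
  -- `size 𝓑 * k`, the second is measured by `sum-deg`.
  edge-count : size 𝓑 * k * 2 ≡ length V * (length V ∸ 1)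
  edge-count = begin
    size 𝓑 * k * 2                                    ≡⟨ cong (λ n → n * k * 2) (length-tabulate {n = size 𝓑} id) ⟨
    length (allFin (size 𝓑)) * k * 2                  ≡⟨ cong (_* 2) (sumOver-const (allFin (size 𝓑)) k) ⟨
    sumOver (allFin (size 𝓑)) (λ _ → k) * 2           ≡⟨ cong (_* 2) (sumOver-cong (allFin (size 𝓑)) (λ {i} _ → length-ends i)) ⟨
    sumOver (allFin (size 𝓑)) (length ∘ ends) * 2     ≡⟨ cong (_* 2) (length-labelled mid ends (allFin (size 𝓑))) ⟨
    length (labelled mid ends (allFin (size 𝓑))) * 2  ≡⟨ cong (_* 2) (unique-⊆⊇-length
                                                           (labelled-unique mid ends (allFin⁺ _) ends-unique same-arc)
                                                           (labelled-unique id out u (λ x → filter⁺ _ u) (λ eq _ _ → eq))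
                                                           arc⊆ arc⊇) ⟩
    length (labelled id out V) * 2                    ≡⟨ cong (_* 2) (length-labelled id out V) ⟩
    sumOver V (length ∘ out) * 2                      ≡⟨ cong (_* 2) (sumOver-cong V (λ {x} _ → length-outs outwards V x)) ⟩
    sumOver V (deg outwards V) * 2                    ≡⟨ sum-deg outwards u ⟩
    length V * (length V ∸ 1)                         ∎
    where
    open ≡-Reasoning
    out = outs outwards V
    arc⊆ : labelled mid ends (allFin (size 𝓑)) ⊆ labelled id out V
    arc⊆ p∈ with ∈-labelled⁻ mid ends {xs = allFin (size 𝓑)} p∈
    ... | i , _ , refl , y∈ =
      ∈-labelled⁺ id out (mid∈V i) (∈-filter⁺ _ (ends⊆V y∈) (out⇒beats (i , refl , y∈)))
    arc⊇ : labelled id out V ⊆ labelled mid ends (allFin (size 𝓑))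
    arc⊇ p∈ with ∈-labelled⁻ id out {xs = V} p∈
    ... | x , x∈ , refl , y∈ with ∈-filter⁻ _ {xs = V} y∈
    ... | y∈V , b with beats⇒out x∈ y∈V b
    ... | i , refl , y∈i = ∈-labelled⁺ mid ends (∈-allFin i) y∈i

HasMod4 : ℕ → Set
HasMod4 n = n % 4 ≡ 0 ⊎ n % 4 ≡ 1

-- For n congruent to 2 or 3 modulo 4, n(n - 1)/2 is odd, whereas the hypothesis makes it `s * 2`.
half-even⇒mod4 : ∀ n s → s * 2 * 2 ≡ n * (n ∸ 1) → HasMod4 n
half-even⇒mod4 n s eq = classify (n % 4) (n / 4) (m%n<n n 4) refl (m≡m%n+[m/n]*n n 4)
  where
  -- Half of the product is written as an odd constant plus an even term of the shape 2bc + 8cc, so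
  -- that `oddly` serves both residues.
  two : ∀ q → (2 + q * 4) * (1 + q * 4) ≡ (1 + (2 * 3 * q + 8 * q * q)) * 2
  two = solve-∀
  three : ∀ q → (3 + q * 4) * (2 + q * 4) ≡ (3 + (2 * 5 * q + 8 * q * q)) * 2
  three = solve-∀
  clash : ∀ m → odd m ≡ true → s * 2 * 2 ≡ m * 2 → HasMod4 n
  clash m o e with () ← trans (sym o) (trans (cong odd (sym (*-cancelʳ-≡ (s * 2) m 2 e))) (odd-double s))
  double : ∀ b c → 2 * b * c + 8 * c * c ≡ (b * c + 4 * c * c) * 2
  double = solve-∀
  oddly : ∀ a b c → odd a ≡ true → odd (a + (2 * b * c + 8 * c * c)) ≡ true
  oddly a b c o rewrite odd-+ a (2 * b * c + 8 * c * c) | o | double b c | odd-double (b * c + 4 * c * c) = refl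
  classify : ∀ r q → r < 4 → n % 4 ≡ r → n ≡ r + q * 4 → HasMod4 n
  classify 0 q _ n%4 _ = inj₁ n%4
  classify 1 q _ n%4 _ = inj₂ n%4
  classify 2 q _ _ refl = clash (1 + (2 * 3 * q + 8 * q * q)) (oddly 1 3 q refl) (trans eq (two q))
  classify 3 q _ _ refl = clash (3 + (2 * 5 * q + 8 * q * q)) (oddly 3 5 q refl) (trans eq (three q))
  classify (suc (suc (suc (suc r)))) q (s≤s (s≤s (s≤s (s≤s ())))) _ _

mod4⇒half-even : ∀ n → HasMod4 n → ∃ λ s → n * (n ∸ 1) ≡ s * 2 * 2
mod4⇒half-even n (inj₁ e) = subst (λ n → ∃ λ s → n * (n ∸ 1) ≡ s * 2 * 2)
  (trans (sym (cong (_+ n / 4 * 4) e)) (sym (m≡m%n+[m/n]*n n 4))) (n / 4 * (n / 4 * 4 ∸ 1) , zero-case (n / 4))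
  where
  zero-case : ∀ q → q * 4 * (q * 4 ∸ 1) ≡ q * (q * 4 ∸ 1) * 2 * 2
  zero-case q = lemma q (q * 4 ∸ 1)
    where
    lemma : ∀ q p → q * 4 * p ≡ q * p * 2 * 2
    lemma = solve-∀
mod4⇒half-even n (inj₂ e) = subst (λ n → ∃ λ s → n * (n ∸ 1) ≡ s * 2 * 2)
  (trans (sym (cong (_+ n / 4 * 4) e)) (sym (m≡m%n+[m/n]*n n 4))) ((1 + n / 4 * 4) * (n / 4) , one-case (n / 4))
  where
  one-case : ∀ q → (1 + q * 4) * (q * 4) ≡ (1 + q * 4) * q * 2 * 2
  one-case = solve-∀

path-order-mod4 : ∀ {V u} → Design (complete V u) (path 3) → HasMod4 (length V)
path-order-mod4 {V} 𝓟 = half-even⇒mod4 (length V) (size 𝓟) (StarSystem.edge-count (design-≅ path3≅star2 𝓟))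

-- If the centre of the small star were a leaf of the large one, its only possible neighbour would
-- be `c`, but it has two distinct neighbours.
centre-of-substar : ∀ {G c ls v} → (φ : G ≅ star 2) → G ≤ᴳ starAt c ls v → centre φ ≡ c
centre-of-substar {v = v} φ (_ , G⊆) with G⊆ (leaf-adj φ (here refl)) | G⊆ (leaf-adj φ (there (here refl))) | centre∷leaves-unique φ
... | inj₁ (eq , _) | _ | _ = eq
... | inj₂ _ | inj₁ (eq , _) | _ = eq
... | inj₂ (a≡c , _) | inj₂ (b≡c , _) | _ ∷ (a≢b ∷ _) ∷ _ = contradiction (trans a≡c (sym b≡c)) a≢b

downlink-centres : ∀ {K Γ V′ u′} (𝓑 : Design K Γ) (𝓟 : Design (complete V′ u′) (path 3)) →
                   DownLink 𝓑 𝓟 → ∀ {c} → HasStarAt 𝓑 c → c ∈ V′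
downlink-centres {V′ = V′} 𝓑 𝓟 (f , sub) (i , ls , v , eq) =
  subst (_∈ V′) (centre-of-substar {v = v} φ (subst (block 𝓟 (f i) ≤ᴳ_) eq (sub i))) (StarSystem.mid∈V 𝓢 (f i))
  where
  𝓢 = design-≅ path3≅star2 𝓟
  φ = block≅ 𝓢 (f i)

-- Lower bounds from star designs with many centres.

ManyCentres : ℕ → ℕ → ℕ → Set₁
ManyCentres k v N = ∃ λ V → Σ (Unique V) λ u → length V ≡ v ×
  Σ (Design (complete V u) (star k)) λ 𝓑 →
  ∃ λ H → Unique H × length H ≡ N × (∀ {c} → c ∈ H → HasStarAt 𝓑 c)

𝓛₂⇒ : ∀ {k v N n} → ManyCentres k v N → 𝓛₂ (star k) v n → n ≥ N × HasMod4 n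
𝓛₂⇒ (V , u , lenV , 𝓑 , H , uH , refl , at) n∈ with n∈ V u lenV 𝓑
... | V′ , u′ , refl , 𝓟 , link =
  unique-⊆-length uH (λ c∈ → downlink-centres 𝓑 𝓟 link (at c∈)) , path-order-mod4 𝓟

-- One vertex gets score 0 and the other `2k - 1` get score `k`; thus `q = 0`, and the required
-- centres are the vertices of `high`.
manyCentres-2k : ∀ k → k > 0 → ManyCentres k (2 * k) (2 * k ∸ 1)
manyCentres-2k k@(suc k′) _ = vertexList , unique-vertexList , length-vertexList , design ,
  high , applyUpTo⁺₁ suc _ (λ i<j _ eq → <⇒≢ i<j (suc-injective eq)) , length-applyUpTo suc _ , star-at-high
  where
  sum≡ : ∀ k h → h * (1 * k) * 2 ≡ 2 * k * h
  sum≡ = solve-∀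
  open TwoScoreDesign k 1 (2 * k ∸ 1) 0 z<s (sum≡ k (2 * k ∸ 1)) z≤n

-- h vertices carry q + 1 stars and the other m carry q, where q = ⌊(v - 1)/2k⌋.
manyCentres : ∀ k → k > 0 → ∀ v → v > 2 * k → 2 * k ∣ v * (v ∸ 1) → ManyCentres k v v
manyCentres k@(suc k′) _ (suc v-1) v>2k 2k∣ with quotient-form
  where
  K = 2 * k
  v = suc v-1
  -- Replacing `v - 1` by its remainder modulo `K` changes `v * (v - 1)` by a multiple of `K`. The
  -- quotient obtained here is the number `h` of vertices with the higher score.
  quotient-form : K ∣ v * (v-1 % K)
  quotient-form = ∣m+n∣m⇒∣n (subst (K ∣_) split 2k∣) (n∣m*n (v * (v-1 / K)))
    where
    split : v * v-1 ≡ v * (v-1 / K) * K + v * (v-1 % K)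
    split = trans (cong (v *_) (m≡m%n+[m/n]*n v-1 K))
      (trans (*-distribˡ-+ v (v-1 % K) _) (trans (+-comm (v * (v-1 % K)) _) (cong (_+ v * (v-1 % K)) (sym (*-assoc v (v-1 / K) K)))))
... | divides h vr≡hK = vertexList , unique-vertexList , trans length-vertexList m+h≡v , design ,
  -- From `v > 2k` follows `q > 0`, so the low vertices are centres too.
  vertexList , unique-vertexList , trans length-vertexList m+h≡v , star-at-all (m≥n⇒m/n>0 (s≤s⁻¹ v>2k))
  where
  K = 2 * k
  v = suc v-1
  q = v-1 / K
  r = v-1 % K
  m = v ∸ h

  h≤v : h ≤ v
  h≤v = *-cancelʳ-≤ h v K (≤-trans (≤-reflexive (sym vr≡hK)) (*-monoʳ-≤ v (<⇒≤ (m%n<n v-1 K))))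

  -- A consequence of `K ≤ v` and `v * r ≡ h * K`. It yields `m - 1 ≤ v - 1 - r = q * K`, hence
  -- Landau's condition for the low vertices.
  r≤h : r ≤ h
  r≤h = *-cancelʳ-≤ r h K (≤-trans (≤-trans (≤-reflexive (*-comm r K)) (*-monoˡ-≤ r (<⇒≤ v>2k))) (≤-reflexive vr≡hK))

  m+h≡v : m + h ≡ v
  m+h≡v = m∸n+n≡m h≤v

  sum≡ : (m * (q * k) + h * (suc q * k)) * 2 ≡ (m + h) * (m + h ∸ 1)
  sum≡ = begin
    (m * (q * k) + h * (suc q * k)) * 2  ≡⟨ expand m h q k ⟩
    (m + h) * (q * K) + h * K            ≡⟨ cong₂ _+_ (cong (_* (q * K)) m+h≡v) (sym vr≡hK) ⟩
    v * (q * K) + v * r                  ≡⟨ +-comm (v * (q * K)) _ ⟩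
    v * r + v * (q * K)                  ≡⟨ *-distribˡ-+ v r (q * K) ⟨
    v * (r + q * K)                      ≡⟨ cong (v *_) (m≡m%n+[m/n]*n v-1 K) ⟨
    v * (v ∸ 1)                          ≡⟨ cong (λ n → n * (n ∸ 1)) m+h≡v ⟨
    (m + h) * (m + h ∸ 1)                ∎
    where
    open ≡-Reasoning
    expand : ∀ m h q k → (m * (q * k) + h * (suc q * k)) * 2 ≡ (m + h) * (q * (2 * k)) + h * (2 * k)
    expand = solve-∀

  low≤ : m * (m ∸ 1) ≤ m * (q * k) * 2
  low≤ = begin
    m * (m ∸ 1)          ≤⟨ *-monoʳ-≤ m m-1≤ ⟩
    m * (q * K)          ≡⟨ rearrange m q k ⟩
    m * (q * k) * 2      ∎
    where
    open ≤-Reasoning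
    rearrange : ∀ m q k → m * (q * (2 * k)) ≡ m * (q * k) * 2
    rearrange = solve-∀
    m-1≤ : m ∸ 1 ≤ q * K
    m-1≤ = begin
      v ∸ h ∸ 1          ≤⟨ ∸-monoˡ-≤ 1 (∸-monoʳ-≤ v r≤h) ⟩
      v ∸ r ∸ 1          ≡⟨ ∸-+-assoc v r 1 ⟩
      v ∸ (r + 1)        ≡⟨ cong (v ∸_) (+-comm r 1) ⟩
      v-1 ∸ r            ≡⟨ cong (_∸ r) (m≡m%n+[m/n]*n v-1 K) ⟩
      r + q * K ∸ r      ≡⟨ m+n∸m≡n r (q * K) ⟩
      q * K              ∎

  open TwoScoreDesign k m h q z<s sum≡ low≤

-- Choosing a path in every star

abstract
  -- Discarding the members of `zs` costs `xs` at most `length zs` elements; `zs` may have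
  -- repetitions and members outside `xs`.
  choose-two : ∀ {xs} → Unique xs → (zs : List ℕ) → 2 + length zs ≤ length xs →
               ∃₂ λ a b → a ∈ xs × b ∈ xs × a ≢ b × a ∉ zs × b ∉ zs
  choose-two {xs} u zs len = pick (filter fresh? xs) (filter⁺ fresh? u) (∈-filter⁻ fresh? {xs = xs})
    (+-cancelˡ-≤ (length zs) _ _ (begin
      length zs + 2                          ≡⟨ +-comm (length zs) 2 ⟩
      2 + length zs                          ≤⟨ len ⟩
      length xs                              ≤⟨ unique-⊆-length u split ⟩
      length (zs ++ filter fresh? xs)        ≡⟨ length-++ zs ⟩
      length zs + length (filter fresh? xs)  ∎))
    where
    open ≤-Reasoning
    fresh? : ∀ x → Dec (¬ x ∈ zs)
    fresh? x = ¬? (x ∈? zs)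
    split : xs ⊆ zs ++ filter fresh? xs
    split {x} x∈ with x ∈? zs
    ... | yes x∈zs = ∈-++⁺ˡ x∈zs
    ... | no x∉zs = ∈-++⁺ʳ zs (∈-filter⁺ fresh? x∈ x∉zs)
    pick : ∀ ys → Unique ys → (∀ {y} → y ∈ ys → y ∈ xs × y ∉ zs) → 2 ≤ length ys →
           ∃₂ λ a b → a ∈ xs × b ∈ xs × a ≢ b × a ∉ zs × b ∉ zs
    pick (a ∷ b ∷ _) ((a≢b ∷ _) ∷ _) from _ =
      let a∈ , a∉ = from (here refl) ; b∈ , b∉ = from (there (here refl)) in a , b , a∈ , b∈ , a≢b , a∉ , b∉
    pick (_ ∷ []) _ _ (s≤s ())

module PathLink {V u k} (𝓑 : Design (complete V u) (star k)) {V′ : List ℕ} (u′ : Unique V′) (D : Tournament) where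
  open StarSystem 𝓑

  -- All that `D` has to preserve of block `i`: two arcs from its centre, ending in `V′`.
  record Choice (i : Fin (size 𝓑)) : Set where
    field
      a b : ℕ
      a∈ends : a ∈ ends i
      b∈ends : b ∈ ends i
      a≢b : a ≢ b
      a∈V′ : a ∈ V′
      b∈V′ : b ∈ V′
      beats-a : beats D (mid i) a ≡ true
      beats-b : beats D (mid i) b ≡ true

  module _ (even : ∀ {c} → c ∈ V′ → odd (deg D V′ c) ≡ false)
           (mid∈V′ : ∀ i → mid i ∈ V′) (choice : ∀ i → Choice i) where

    private
      module C (i : Fin (size 𝓑)) = Choice (choice i)

      pair : Fin (size 𝓑) → List ℕ
      pair i = C.a i ∷ C.b i ∷ []

      blocksAt : ℕ → List (Fin (size 𝓑))
      blocksAt c = filter (λ i → mid i ≟ c) (allFin (size 𝓑))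

      chosen : ℕ → List ℕ
      chosen c = concat (map pair (blocksAt c))

      unchosen? : ∀ c y → Dec (¬ y ∈ chosen c)
      unchosen? c y = ¬? (y ∈? chosen c)

      rest : ℕ → List ℕ
      rest c = filter (unchosen? c) (outs D V′ c)

      pair⊆ends : ∀ {i y} → y ∈ pair i → y ∈ ends i
      pair⊆ends {i} (here refl) = C.a∈ends i
      pair⊆ends {i} (there (here refl)) = C.b∈ends i

      pair-sound : ∀ {i y} → y ∈ pair i → y ∈ V′ × beats D (mid i) y ≡ true
      pair-sound {i} (here refl) = C.a∈V′ i , C.beats-a i
      pair-sound {i} (there (here refl)) = C.b∈V′ i , C.beats-b i

      ∈-blocksAt : ∀ {c i} → i ∈ blocksAt c → mid i ≡ c
      ∈-blocksAt {c} i∈ = proj₂ (∈-filter⁻ (λ i → mid i ≟ c) {xs = allFin (size 𝓑)} i∈)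

      chosen-sound : ∀ {c y} → y ∈ chosen c → y ∈ V′ × beats D c y ≡ true
      chosen-sound {c} y∈ with ∈-concat⁻′ (map pair (blocksAt c)) y∈
      ... | _ , y∈p , p∈ with ∈-map⁻ pair p∈
      ... | i , i∈ , refl with ∈-blocksAt i∈
      ... | refl = pair-sound y∈p

      chosen-unique : ∀ c → Unique (chosen c)
      chosen-unique c = concat⁺
        (All.map⁺ (All.tabulate λ {i} _ → (C.a≢b i ∷ []) ∷ [] ∷ []))
        (AllPairs.map⁺ (allPairs-∈ apart (filter⁺ _ (allFin⁺ (size 𝓑)))))
        where
        apart : ∀ {i j} → i ∈ blocksAt c → j ∈ blocksAt c → i ≢ j → Disjoint (pair i) (pair j)
        apart i∈ j∈ i≢j (y∈i , y∈j) =
          i≢j (same-arc (trans (∈-blocksAt i∈) (sym (∈-blocksAt j∈))) (pair⊆ends y∈i) (pair⊆ends y∈j))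

      outs-unique : ∀ c → Unique (outs D V′ c)
      outs-unique c = filter⁺ _ u′

      rest-unique : ∀ c → Unique (rest c)
      rest-unique c = filter⁺ (unchosen? c) (outs-unique c)

      ∈-rest⁻ : ∀ {c y} → y ∈ rest c → y ∈ outs D V′ c × y ∉ chosen c
      ∈-rest⁻ {c} = ∈-filter⁻ (unchosen? c) {xs = outs D V′ c}

      outs⊆ : ∀ {c} → outs D V′ c ⊆ chosen c ++ rest c
      outs⊆ {c} {y} y∈ with y ∈? chosen c
      ... | yes y∈c = ∈-++⁺ˡ y∈c
      ... | no y∉c = ∈-++⁺ʳ (chosen c) (∈-filter⁺ (unchosen? c) y∈ y∉c)

      ⊆outs : ∀ {c} → chosen c ++ rest c ⊆ outs D V′ c
      ⊆outs {c} y∈ with ∈-++⁻ (chosen c) y∈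
      ... | inj₁ y∈c = let y∈V′ , b = chosen-sound {c} y∈c in ∈-filter⁺ _ y∈V′ b
      ... | inj₂ y∈r = proj₁ (∈-rest⁻ {c} y∈r)

      length-chosen : ∀ is → length (concat (map pair is)) ≡ length is * 2
      length-chosen [] = refl
      length-chosen (i ∷ is) = cong (2 +_) (length-chosen is)

      -- Each block centred at `c` contributes exactly two chosen out-neighbours, and different
      -- blocks contribute different ones, so the rest has the parity of the out-degree.
      rest-even : ∀ {c} → c ∈ V′ → odd (length (rest c)) ≡ false
      rest-even {c} c∈ = begin
        odd (length (rest c))                             ≡⟨ cong (_xor odd (length (rest c))) (odd-double (length (blocksAt c))) ⟨
        odd (length (blocksAt c) * 2) xor odd (length (rest c)) ≡⟨ odd-+ (length (blocksAt c) * 2) (length (rest c)) ⟨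
        odd (length (blocksAt c) * 2 + length (rest c))   ≡⟨ cong (λ n → odd (n + length (rest c))) (length-chosen (blocksAt c)) ⟨
        odd (length (chosen c) + length (rest c))         ≡⟨ cong odd (length-++ (chosen c)) ⟨
        odd (length (chosen c ++ rest c))                 ≡⟨ cong odd (unique-⊆⊇-length
                                                               (++⁺ (chosen-unique c) (rest-unique c) (λ (y∈c , y∈r) → proj₂ (∈-rest⁻ {c} y∈r) y∈c))
                                                               (outs-unique c) ⊆outs outs⊆) ⟩
        odd (length (outs D V′ c))                        ≡⟨ cong odd (length-outs D V′ c) ⟩
        odd (deg D V′ c)                                  ≡⟨ even c∈ ⟩
        false                                             ∎
        where open ≡-Reasoning

      -- `Splitting` asks for groups at every number. On `V′` the division is exact; elsewhere it
      -- may round down, and `chunks` then drops an element.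
      half : ℕ → ℕ
      half c = length (rest c) / 2

      length-rest : ∀ {c} → c ∈ V′ → length (rest c) ≡ half c * 2
      length-rest {c} c∈ with length (rest c) | even⇒double (length (rest c)) (rest-even c∈)
      ... | _ | j , refl = cong (_* 2) (sym (m*n/n≡m j 2))

      -- The chosen pairs are groups of their own, so each of them becomes a block to which the
      -- down-link can point.
      groupsAt : ℕ → List (List ℕ)
      groupsAt c = map pair (blocksAt c) ++ chunks (half c) 2 (rest c)

      concat-groups : ∀ c → concat (groupsAt c) ≡ chosen c ++ concat (chunks (half c) 2 (rest c))
      concat-groups c = sym (concat-++ (map pair (blocksAt c)) _)

      splitting : Splitting V′ D 2
      splitting = record
        { groups        = groupsAt
        ; length-≡      = size-two
        ; groups-unique = λ c → subst Unique (sym (concat-groups c))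
            (++⁺ (chosen-unique c) (chunks-unique (half c) 2 (rest-unique c))
              (λ (y∈c , y∈r) → proj₂ (∈-rest⁻ {c} (chunks-⊆ (half c) 2 (rest c) y∈r)) y∈c))
        ; sound         = λ {c} y∈ → group-sound {c} (subst (_ ∈_) (concat-groups c) y∈)
        ; exhaustive    = λ {c} c∈ y∈ b → subst (_ ∈_) (sym (concat-groups c))
            (subst (λ r → _ ∈ chosen c ++ r) (sym (chunks-complete (half c) 2 (rest c) (length-rest c∈)))
              (outs⊆ {c} (∈-filter⁺ _ y∈ b)))
        }
        where
        size-two : ∀ {c g} → c ∈ V′ → g ∈ groupsAt c → length g ≡ 2
        size-two {c} c∈ g∈ with ∈-++⁻ (map pair (blocksAt c)) g∈
        ... | inj₂ g∈r = length-chunks (half c) 2 (rest c) (length-rest c∈) g∈r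
        ... | inj₁ g∈p with ∈-map⁻ pair g∈p
        ... | i , _ , refl = refl
        group-sound : ∀ {c y} → y ∈ chosen c ++ concat (chunks (half c) 2 (rest c)) → y ∈ V′ × beats D c y ≡ true
        group-sound {c} y∈ with ∈-++⁻ (chosen c) y∈
        ... | inj₁ y∈c = chosen-sound {c} y∈c
        ... | inj₂ y∈r = ∈-filter⁻ _ {xs = V′} (proj₁ (∈-rest⁻ {c} (chunks-⊆ (half c) 2 (rest c) y∈r)))

      paths : Design (complete V′ u′) (star 2)
      paths = starDesign u′ z<s splitting

      pair-block : ∀ i → ∃ λ j → ∃ λ v → block paths j ≡ starAt (mid i) (pair i) v
      pair-block i = starDesign-block u′ z<s splitting (mid∈V′ i)
        (∈-++⁺ˡ (∈-map⁺ pair (∈-filter⁺ (λ j → mid j ≟ mid i) (∈-allFin i) refl)))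

      pair-star≤ : ∀ i v → starAt (mid i) (pair i) v ≤ᴳ block 𝓑 i
      pair-star≤ i v = vertex , λ { (inj₁ (refl , y∈)) → end-adj (pair⊆ends y∈)
                                  ; (inj₂ (refl , x∈)) → adj-sym (block 𝓑 i) (end-adj (pair⊆ends x∈)) }
        where
        vertex : mid i ∷ pair i ⊆ vertices (block 𝓑 i)
        vertex (here refl) = centre-∈ (block≅ 𝓑 i)
        vertex (there y∈) = adj-∈ (block 𝓑 i) (adj-sym (block 𝓑 i) (end-adj (pair⊆ends y∈)))

    path-link : Σ (Design (complete V′ u′) (path 3)) (DownLink 𝓑)
    path-link = design-≅ (≅-sym path3≅star2) paths , proj₁ ∘ pair-block ,
      λ i → let _ , v , eq = pair-block i in subst (_≤ᴳ block 𝓑 i) (sym eq) (pair-star≤ i v)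

-- Parity repair

odd-deg : ∀ D V x → odd (deg D V x) ≡ xorOver V (beats D x)
odd-deg D V x = trans (odd-sumOver V _) (xorOver-cong V (λ {y} _ → odd-⟦⟧ (beats D x y)))

-- Every vertex of s with odd out-degree reverses its edge to p; since p leaves s,
-- these reversals do not interfere with each other.
module Repair {V : List ℕ} (u : Unique V) (D : Tournament) (s : ℕ → Bool) (p : ℕ → ℕ)
  (p∈V : ∀ {x} → s x ≡ true → p x ∈ V) (p∉s : ∀ {x} → s x ≡ true → s (p x) ≡ false) where

  private
    needy : ℕ → Bool
    needy x = s x ∧ odd (deg D V x)

    arc : ℕ → ℕ → Bool
    arc x y = needy x ∧ δ (p x) y

  Reversed : ℕ → ℕ → Set
  Reversed x y = s x ≡ true × odd (deg D V x) ≡ true × p x ≡ y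

  abstract
    repaired : Tournament
    -- Symmetrising by xor lets `repaired-even` split the change of parity into an outgoing and an
    -- incoming part.
    repaired = flipEdges D (λ x y → arc x y xor arc y x) (λ x y → xor-comm (arc x y) (arc y x)) (λ x → xor-same (arc x x))

    repaired-even : ∀ {x} → s x ≡ true → odd (deg repaired V x) ≡ false
    repaired-even {x} sx = begin
      odd (deg repaired V x)                                        ≡⟨ odd-deg repaired V x ⟩
      xorOver V (λ y → beats D x y xor (arc x y xor arc y x))       ≡⟨ xorOver-xor V _ _ ⟩
      xorOver V (beats D x) xor xorOver V (λ y → arc x y xor arc y x) ≡⟨ cong₂ _xor_ (sym (odd-deg D V x)) (xorOver-xor V _ _) ⟩
      odd (deg D V x) xor (xorOver V (arc x) xor xorOver V (λ y → arc y x))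
        ≡⟨ cong (odd (deg D V x) xor_) (cong₂ _xor_ (xorOver-δ (needy x) u (p∈V sx)) (xorOver-false V λ {y} _ → incoming y)) ⟩
      odd (deg D V x) xor (needy x xor false)                       ≡⟨ cong (odd (deg D V x) xor_) (xor-identityʳ (needy x)) ⟩
      odd (deg D V x) xor (s x ∧ odd (deg D V x))                   ≡⟨ cong (λ b → odd (deg D V x) xor (b ∧ odd (deg D V x))) sx ⟩
      odd (deg D V x) xor odd (deg D V x)                           ≡⟨ xor-same (odd (deg D V x)) ⟩
      false                                                         ∎
      where
      open ≡-Reasoning
      incoming : ∀ y → arc y x ≡ false
      incoming y with s y in sy
      ... | false = refl
      ... | true with p y ≟ x
      ... | yes refl with () ← trans (sym sx) (p∉s sy)
      incoming y | true | no py≢x rewrite δ-≢ py≢x = ∧-zeroʳ (odd (deg D V y))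

    no-arc : ∀ x y → ¬ Reversed x y → arc x y ≡ false
    no-arc x y ¬r with s x | odd (deg D V x)
    ... | false | _ = refl
    ... | true | false = refl
    ... | true | true = δ-≢ (λ eq → ¬r (refl , refl , eq))

    unreversed : ∀ {x y} → ¬ Reversed x y → ¬ Reversed y x → beats repaired x y ≡ beats D x y
    unreversed {x} {y} ¬xy ¬yx rewrite no-arc x y ¬xy | no-arc y x ¬yx = xor-identityʳ (beats D x y)

-- The out-degrees add up to n(n - 1)/2, which is even for these orders; modulo 2 only the term of
-- `h` remains.
last-even : ∀ {V} → Unique V → (D : Tournament) → HasMod4 (length V) → ∀ {h} → h ∈ V →
            (∀ {x} → x ≢ h → odd (deg D V x) ≡ false) → odd (deg D V h) ≡ false
last-even {V} u D mod4 {h} h∈ others with mod4⇒half-even (length V) mod4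
... | s , eq = begin
  odd (deg D V h)                                 ≡⟨ xorOver-δ (odd (deg D V h)) u h∈ ⟨
  xorOver V (λ y → odd (deg D V h) ∧ δ h y)       ≡⟨ xorOver-cong V (λ {y} _ → concentrated y) ⟨
  xorOver V (odd ∘ deg D V)                       ≡⟨ odd-sumOver V (deg D V) ⟨
  odd (sumOver V (deg D V))                       ≡⟨ cong odd (*-cancelʳ-≡ (sumOver V (deg D V)) (s * 2) 2 (trans (sum-deg D u) eq)) ⟩
  odd (s * 2)                                     ≡⟨ odd-double s ⟩
  false                                           ∎
  where
  open ≡-Reasoning
  concentrated : ∀ y → odd (deg D V y) ≡ odd (deg D V h) ∧ δ h y
  concentrated y with y ≟ h
  ... | yes refl rewrite δ-refl y = sym (∧-identityʳ (odd (deg D V y)))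
  ... | no y≢h rewrite δ-≢ (y≢h ∘ sym) | ∧-zeroʳ (odd (deg D V h)) = others y≢h

-- The hub construction.

module Hub {V : List ℕ} {u : Unique V} {k : ℕ} (k>3 : k > 3) (𝓑 : Design (complete V u) (star k))
  {V′ : List ℕ} (u′ : Unique V′) (V⊆V′ : V ⊆ V′) (mod4 : HasMod4 (length V′)) {h : ℕ} (h∈V : h ∈ V) where

  open StarSystem 𝓑

  four-ends : ∀ i → 4 ≤ length (ends i)
  four-ends i = ≤-trans k>3 (≤-reflexive (sym (length-ends i)))

  record Triple (i : Fin (size 𝓑)) : Set where
    field
      a b w : ℕ
      a∈ : a ∈ ends i
      b∈ : b ∈ ends i
      w∈ : w ∈ ends i
      a≢b : a ≢ b
      w≢a : w ≢ a
      w≢b : w ≢ b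

  abstract
    triple : ∀ i → Triple i
    triple i with choose-two (ends-unique i) [] (≤-trans (s≤s (s≤s z≤n)) (four-ends i))
    -- Two leaves besides `a` and `b` are available because `k > 3`; one of them becomes `w`.
    ... | a , b , a∈ , b∈ , a≢b , _ with choose-two (ends-unique i) (a ∷ b ∷ []) (four-ends i)
    ... | w , _ , w∈ , _ , _ , w∉ , _ = record
      { a = a ; b = b ; w = w ; a∈ = a∈ ; b∈ = b∈ ; w∈ = w∈ ; a≢b = a≢b
      ; w≢a = λ { refl → w∉ (here refl) } ; w≢b = λ { refl → w∉ (there (here refl)) } }

  module T (i : Fin (size 𝓑)) = Triple (triple i)

  -- The edge from x to h is reserved for the path in block i, so the parity of x is
  -- repaired through the leaf w of that block.
  Detour : ℕ → Fin (size 𝓑) → Set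
  Detour x i = mid i ≡ h × (x ≡ T.a i ⊎ x ≡ T.b i)

  detour? : ∀ x → Dec (∃ (Detour x))
  detour? x = Fin.any? λ i → (mid i ≟ h) ×-dec ((x ≟ T.a i) ⊎-dec (x ≟ T.b i))

  detours : ℕ → Bool
  detours x = does (detour? x)

  via : ℕ → ℕ
  via x with detour? x
  ... | yes (i , _) = T.w i
  ... | no _ = h

  detours⇒ : ∀ {x} → detours x ≡ true → ∃ λ i → Detour x i × via x ≡ T.w i
  detours⇒ {x} eq with detour? x
  ... | yes (i , d) = i , d , refl

  detour-end : ∀ {x i} → Detour x i → x ∈ ends i
  detour-end {i = i} (_ , inj₁ refl) = T.a∈ i
  detour-end {i = i} (_ , inj₂ refl) = T.b∈ i

  -- If `w` were reserved in a block `j`, the arc from `h` to `w` would lie in both blocks, forcing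
  -- `i ≡ j`; but within one block `w` differs from `a` and `b`.
  w-direct : ∀ {i} → mid i ≡ h → detours (T.w i) ≡ false
  w-direct {i} mid≡h = dec-false (detour? (T.w i)) λ (j , d) → clash d (same-arc (trans mid≡h (sym (proj₁ d))) (T.w∈ i) (detour-end d))
    where
    clash : ∀ {j} → Detour (T.w i) j → ¬ i ≡ j
    clash (_ , inj₁ eq) refl = T.w≢a i eq
    clash (_ , inj₂ eq) refl = T.w≢b i eq

  via∈V′ : ∀ {x} → detours x ≡ true → via x ∈ V′
  via∈V′ eq with detours⇒ eq
  ... | i , _ , via≡ = subst (_∈ V′) (sym via≡) (V⊆V′ (ends⊆V (T.w∈ i)))

  via-direct : ∀ {x} → detours x ≡ true → detours (via x) ≡ false
  via-direct eq with detours⇒ eq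
  ... | i , (mid≡h , _) , via≡ = trans (cong detours via≡) (w-direct mid≡h)

  h-direct : ∀ {x} → detours x ≡ true → x ≢ h
  h-direct eq refl with detours⇒ eq
  ... | i , d , _ = mid≢end (detour-end d) (proj₁ d)

  -- `outwards` orients every pair of numbers, so it also covers the vertices of `V′` outside `V`.
  -- The first stage settles the leaves `a` and `b` of the stars at the hub, the second all
  -- remaining vertices except `h`.
  module Stage₁ = Repair u′ outwards detours via via∈V′ via-direct

  awayFromHub : ℕ → Bool
  awayFromHub x = not (δ h x)

  away⇒≢ : ∀ {x} → awayFromHub x ≡ true → x ≢ h
  away⇒≢ {x} eq refl with () ← trans (sym eq) (cong not (δ-refl x))

  ≢⇒away : ∀ {x} → x ≢ h → awayFromHub x ≡ true
  ≢⇒away x≢h = cong not (δ-≢ (x≢h ∘ sym))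

  module Stage₂ = Repair u′ Stage₁.repaired awayFromHub (λ _ → h) (λ _ → V⊆V′ h∈V) (λ _ → cong not (δ-refl h))

  D = Stage₂.repaired

  D-even : ∀ {x} → x ∈ V′ → odd (deg D V′ x) ≡ false
  D-even {x} _ with x ≟ h
  ... | no x≢h = Stage₂.repaired-even (≢⇒away x≢h)
  ... | yes refl = last-even u′ D mod4 (V⊆V′ h∈V) (λ x≢h → Stage₂.repaired-even (≢⇒away x≢h))

  -- The four exclusions are the four ways to lose the arc: in either stage, at the request of
  -- either endpoint.
  arc-kept : ∀ {i y} → y ∈ ends i →
    ¬ (detours (mid i) ≡ true × via (mid i) ≡ y) →
    ¬ (detours y ≡ true × via y ≡ mid i) →
    ¬ Stage₂.Reversed (mid i) y → ¬ Stage₂.Reversed y (mid i) →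
    beats D (mid i) y ≡ true
  arc-kept {i} y∈ n₁ n₂ n₃ n₄ = trans (Stage₂.unreversed n₃ n₄)
    (trans (Stage₁.unreversed (λ (s , _ , p) → n₁ (s , p)) (λ (s , _ , p) → n₂ (s , p)))
      (out⇒beats (i , refl , y∈)))

  -- The hub itself never asks for a reversal. Its reserved neighbour `y` is repaired through some
  -- `w`, which differs from `h`, and is already even when the second stage begins.
  hub-arc : ∀ {i y} → Detour y i → beats D (mid i) y ≡ true
  hub-arc {i} {y} d@(refl , _) = arc-kept (detour-end d)
    (λ (s , _) → h-direct s refl)
    (λ (s , v) → let j , (mid≡h , _) , via≡ = detours⇒ s in mid≢end (T.w∈ j) (trans mid≡h (trans (sym v) via≡)))
    (λ (away , _) → away⇒≢ away refl)
    (λ (_ , o , _) → case trans (sym o) (Stage₁.repaired-even (dec-true (detour? y) (i , d))) of λ ())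

  open PathLink 𝓑 u′ D

  mid∈V′ : ∀ i → mid i ∈ V′
  mid∈V′ i = V⊆V′ (mid∈V i)

  choice-avoiding : ∀ i (zs : List ℕ) → length zs ≤ 2 →
    (∀ {y} → y ∈ ends i → y ∉ zs → beats D (mid i) y ≡ true) → Choice i
  choice-avoiding i zs ≤2 kept with choose-two (ends-unique i) zs (≤-trans (+-monoʳ-≤ 2 ≤2) (four-ends i))
  ... | a , b , a∈ , b∈ , a≢b , a∉ , b∉ = record
    { a = a ; b = b ; a∈ends = a∈ ; b∈ends = b∈ ; a≢b = a≢b
    ; a∈V′ = V⊆V′ (ends⊆V a∈) ; b∈V′ = V⊆V′ (ends⊆V b∈)
    ; beats-a = kept a∈ a∉ ; beats-b = kept b∈ b∉ }

  -- In a block not centred at h, the edges that may get reversed are those listed in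
  -- the argument zs of choice-avoiding.
  choice : ∀ i → Choice i
  choice i with mid i ≟ h
  ... | yes mid≡h = record
    { a = T.a i ; b = T.b i ; a∈ends = T.a∈ i ; b∈ends = T.b∈ i ; a≢b = T.a≢b i
    ; a∈V′ = V⊆V′ (ends⊆V (T.a∈ i)) ; b∈V′ = V⊆V′ (ends⊆V (T.b∈ i))
    ; beats-a = hub-arc (mid≡h , inj₁ refl) ; beats-b = hub-arc (mid≡h , inj₂ refl) }
  ... | no mid≢h with detours (mid i) in di
  -- A centre that detours loses at most its arc to `via`: no vertex detours through it, and it
  -- enters the second stage even.
  ... | true = choice-avoiding i (via (mid i) ∷ []) (s≤s z≤n) λ {y} y∈ y∉ → arc-kept y∈
    (λ (_ , v) → y∉ (here (sym v)))
    (λ (s , v) → case trans (sym di) (trans (cong detours (sym v)) (via-direct s)) of λ ())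
    (λ (_ , o , _) → case trans (sym o) (Stage₁.repaired-even di) of λ ())
    (λ (_ , _ , h≡) → mid≢h (sym h≡))
  ... | false with Fin.any? (λ j → (mid j ≟ h) ×-dec (T.w j ≟ mid i))
  -- Here the centre is the leaf `w` of a star at `h`. Only `a` and `b` of that star detour through
  -- it, and `h` is not among its own leaves, since their common edge is directed away from `h`.
  ... | yes (j , mid≡h , w≡) = choice-avoiding i (T.a j ∷ T.b j ∷ []) ≤-refl λ {y} y∈ y∉ → arc-kept y∈
    (λ (s , _) → case trans (sym di) s of λ ())
    (λ (s , v) → y∉ (used s v))
    (λ { (_ , _ , refl) → opposite-arcs {i} {j} (subst (_∈ ends i) (sym mid≡h) y∈) (subst (_∈ ends j) w≡ (T.w∈ j)) })
    (λ (_ , _ , h≡) → mid≢h (sym h≡))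
    where
    used : ∀ {y} → detours y ≡ true → via y ≡ mid i → y ∈ T.a j ∷ T.b j ∷ []
    used s v with detours⇒ s
    ... | j′ , (mid′≡h , y≡) , via≡
      -- Both hub stars contain the arc from `h` to `mid i`, so they coincide.
      with same-arc (trans mid′≡h (sym mid≡h)) (T.w∈ j′) (subst (_∈ ends j) (trans w≡ (trans (sym v) via≡)) (T.w∈ j))
    ... | refl with y≡
    ... | inj₁ eq = here eq
    ... | inj₂ eq = there (here eq)
  -- Nothing is rerouted through this centre, so it can lose only an arc to `h`, in the second
  -- stage.
  ... | no none = choice-avoiding i (h ∷ []) (s≤s z≤n) λ {y} y∈ y∉ → arc-kept y∈
    (λ (s , _) → case trans (sym di) s of λ ())
    (λ (s , v) → let j , (mid≡h , _) , via≡ = detours⇒ s in none (j , mid≡h , trans (sym via≡) v))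
    (λ (_ , _ , h≡) → y∉ (here (sym h≡)))
    (λ (_ , _ , h≡) → mid≢h (sym h≡))

  hub-link : Σ (Design (complete V′ u′) (path 3)) (DownLink 𝓑)
  hub-link = path-link D-even mid∈V′ choice

-- The orders n ≥ v, and the order 2k - 1 for v = 2k.

∈⇒≤sumOver : ∀ {xs x} → x ∈ xs → x ≤ sumOver xs id
∈⇒≤sumOver (here refl) = m≤m+n _ _
∈⇒≤sumOver (there x∈) = ≤-trans (∈⇒≤sumOver x∈) (m≤n+m _ _)

-- The new vertices are numbered beyond the sum of `V`, which bounds each of its entries.
extend : ∀ {V} → Unique V → ∀ {n} → length V ≤ n → ∃ λ V′ → Unique V′ × length V′ ≡ n × V ⊆ V′
extend {V} u {n} le = V ++ new , ++⁺ u (applyUpTo⁺₁ f d (λ i<j _ eq → <⇒≢ i<j (+-cancelˡ-≡ (suc (sumOver V id)) _ _ eq))) apart ,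
  trans (length-++ V) (trans (cong (length V +_) (length-applyUpTo f d)) (m+[n∸m]≡n le)) , ∈-++⁺ˡ
  where
  d = n ∸ length V
  f : ℕ → ℕ
  f = suc (sumOver V id) +_
  new = applyUpTo f d
  apart : Disjoint V new
  apart (x∈V , x∈new) with ∈-applyUpTo⁻ f x∈new
  ... | i , _ , refl = <⇒≱ (s≤s (m≤m+n (sumOver V id) i)) (∈⇒≤sumOver x∈V)

-- Any vertex can serve as the hub; the first one in the list is taken.
large⇒𝓛₂ : ∀ {k v n} → k > 3 → 0 < v → n ≥ v → HasMod4 n → 𝓛₂ (star k) v n
large⇒𝓛₂ k>3 0<v n≥v mod4 (h ∷ V) u refl 𝓑 with extend u n≥v
... | V′ , u′ , refl , sub = V′ , u′ , refl , Hub.hub-link k>3 𝓑 u′ sub mod4 (here refl)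

-- A design of order 2k has 2k - 1 stars, so some vertex z is not a centre. Every
-- other vertex is the centre of exactly one star, which contains z; without z its
-- out-degree is k - 1, which is even when 2k - 1 ≡ 0, 1 (mod 4).
module OrderMinusOne {j : ℕ} (k>3 : suc j > 3) (mod4 : HasMod4 (2 * suc j ∸ 1)) {V : List ℕ} {u : Unique V}
  (order : length V ≡ 2 * suc j) (𝓑 : Design (complete V u) (star (suc j))) where

  k : ℕ
  k = suc j

  open StarSystem 𝓑

  size≡ : size 𝓑 ≡ 2 * k ∸ 1
  size≡ = *-cancelʳ-≡ (size 𝓑) (2 * k ∸ 1) (2 * k) (begin
    size 𝓑 * (2 * k)                  ≡⟨ rearrange (size 𝓑) k ⟩
    size 𝓑 * k * 2                    ≡⟨ edge-count ⟩
    length V * (length V ∸ 1)         ≡⟨ cong (λ v → v * (v ∸ 1)) order ⟩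
    2 * k * (2 * k ∸ 1)               ≡⟨ *-comm (2 * k) _ ⟩
    (2 * k ∸ 1) * (2 * k)             ∎)
    where
    open ≡-Reasoning
    rearrange : ∀ s k → s * (2 * k) ≡ s * k * 2
    rearrange = solve-∀

  mids : List ℕ
  mids = map mid (allFin (size 𝓑))

  length-mids : length mids ≡ 2 * k ∸ 1
  length-mids = trans (length-map mid (allFin (size 𝓑))) (trans (length-tabulate {n = size 𝓑} id) size≡)

  nonCentre : ∃ λ z → z ∈ V × (∀ i → mid i ≢ z)
  nonCentre with Any.any? (λ x → ¬? (x ∈? mids)) V
  ... | yes some = let z , z∈ , z∉ = find some in z , z∈ , λ i eq → z∉ (subst (_∈ mids) eq (∈-map⁺ mid (∈-allFin i)))
  ... | no none = contradiction (subst₂ _≤_ order length-mids (unique-⊆-length u V⊆mids)) 1+n≰n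
    where
    V⊆mids : V ⊆ mids
    V⊆mids {x} x∈ with x ∈? mids
    ... | yes x∈m = x∈m
    ... | no x∉m = contradiction (lose x∈ x∉m) none

  z = proj₁ nonCentre
  z∈V = proj₁ (proj₂ nonCentre)
  mid≢z = proj₂ (proj₂ nonCentre)

  ≢z? : ∀ x → Dec (x ≢ z)
  ≢z? x = ¬? (x ≟ z)

  V′ : List ℕ
  V′ = filter ≢z? V

  u′ : Unique V′
  u′ = filter⁺ ≢z? u

  ∈V′⁻ : ∀ {x} → x ∈ V′ → x ∈ V × x ≢ z
  ∈V′⁻ = ∈-filter⁻ ≢z? {xs = V}

  ∈V′⁺ : ∀ {x} → x ∈ V → x ≢ z → x ∈ V′
  ∈V′⁺ = ∈-filter⁺ ≢z?

  order′ : length V′ ≡ 2 * k ∸ 1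
  order′ = cong (_∸ 1) (trans (unique-⊆⊇-length (z∉V′ ∷ u′) u back forth) order)
    where
    z∉V′ : All (z ≢_) V′
    z∉V′ = All.tabulate λ x∈ → proj₂ (∈V′⁻ x∈) ∘ sym
    back : z ∷ V′ ⊆ V
    back (here refl) = z∈V
    back (there x∈) = proj₁ (∈V′⁻ x∈)
    forth : V ⊆ z ∷ V′
    forth {x} x∈ with x ≟ z
    ... | yes eq = here eq
    ... | no x≢z = there (∈V′⁺ x∈ x≢z)

  -- Two stars with the same centre have disjoint leaf sets and would together occupy `2k + 1`
  -- vertices.
  one-star : ∀ i j → mid i ≡ mid j → i ≡ j
  one-star i j eq with i Fin.≟ j
  ... | yes i≡j = i≡j
  ... | no i≢j = contradiction (begin
      suc (2 * k)                             ≡⟨ cong suc (trans (double k) (sym (cong₂ _+_ (length-ends i) (length-ends j)))) ⟩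
      suc (length (ends i) + length (ends j)) ≡⟨ cong suc (length-++ (ends i)) ⟨
      length (mid i ∷ ends i ++ ends j)       ≤⟨ unique-⊆-length
                                                   (All.++⁺ (AllPairs.head (mid∷ends-unique i))
                                                     (subst (λ m → All (m ≢_) (ends j)) (sym eq) (AllPairs.head (mid∷ends-unique j)))
                                                    ∷ ++⁺ (ends-unique i) (ends-unique j) (λ (p , q) → i≢j (same-arc eq p q)))
                                                   inside ⟩
      length V                                ≡⟨ order ⟩
      2 * k                                   ∎) 1+n≰n
    where
    open ≤-Reasoning
    double : ∀ k → 2 * k ≡ k + k
    double = solve-∀
    inside : mid i ∷ ends i ++ ends j ⊆ V
    inside (here refl) = mid∈V i
    inside (there x∈) = [ ends⊆V , ends⊆V ]′ (∈-++⁻ (ends i) x∈)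

  -- With `k = j + 1`, the number of edges of the complete graph of order 2k - 1 is j + 2jj; it is
  -- even and has the parity of `j`.
  k-1-even : odd j ≡ false
  k-1-even with mod4⇒half-even (2 * k ∸ 1) mod4
  ... | s , eq = begin
    odd j                       ≡⟨ xor-identityʳ (odd j) ⟨
    odd j xor false             ≡⟨ cong (odd j xor_) (odd-double (j * j)) ⟨
    odd j xor odd (j * j * 2)   ≡⟨ odd-+ j (j * j * 2) ⟨
    odd (j + j * j * 2)         ≡⟨ cong odd (*-cancelʳ-≡ (j + j * j * 2) (s * 2) 2 (trans (expand j) (trans (cong (λ n → n * (n ∸ 1)) (shape j)) eq))) ⟩
    odd (s * 2)                 ≡⟨ odd-double s ⟩
    false                       ∎
    where
    open ≡-Reasoning
    expand : ∀ j → (j + j * j * 2) * 2 ≡ (1 + j * 2) * (j * 2)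
    expand = solve-∀
    shape : ∀ j → 1 + j * 2 ≡ j + (1 + j + 0)
    shape = solve-∀

  -- The edge joining `c` and `z` lies in a star, and `z` is not a centre, so this is the star at
  -- `c`.
  deg-even : ∀ {c} → c ∈ V′ → odd (deg outwards V′ c) ≡ false
  deg-even {c} c∈ with out-cover (proj₁ (∈V′⁻ c∈)) z∈V (proj₂ (∈V′⁻ c∈))
  ... | inj₂ (i , mid≡z , _) = contradiction mid≡z (mid≢z i)
  ... | inj₁ (i , refl , z∈i) = trans (cong odd deg≡) k-1-even
    where
    out = outs outwards V′ (mid i)
    back : z ∷ out ⊆ ends i
    back (here refl) = z∈i
    back (there y∈) with ∈-filter⁻ _ {xs = V′} y∈
    ... | y∈V′ , b with beats⇒out (mid∈V i) (proj₁ (∈V′⁻ y∈V′)) b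
    ... | j , mid≡ , y∈j = subst (λ l → _ ∈ ends l) (one-star j i mid≡) y∈j
    forth : ends i ⊆ z ∷ out
    forth {y} y∈ with y ≟ z
    ... | yes eq = here eq
    ... | no y≢z = there (∈-filter⁺ _ (∈V′⁺ (ends⊆V y∈) y≢z) (out⇒beats (i , refl , y∈)))
    z∉out : All (z ≢_) out
    z∉out = All.tabulate λ y∈ → proj₂ (∈V′⁻ (proj₁ (∈-filter⁻ _ {xs = V′} y∈))) ∘ sym
    deg≡ : deg outwards V′ (mid i) ≡ k ∸ 1
    deg≡ = trans (sym (length-outs outwards V′ (mid i)))
      (cong (_∸ 1) (trans (unique-⊆⊇-length (z∉out ∷ filter⁺ _ u′) (ends-unique i) back forth) (length-ends i)))

  open PathLink 𝓑 u′ outwards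

  choice : ∀ i → Choice i
  choice i with choose-two (ends-unique i) (z ∷ []) (≤-trans (<⇒≤ k>3) (≤-reflexive (sym (length-ends i))))
  ... | a , b , a∈ , b∈ , a≢b , a∉ , b∉ = record
    { a = a ; b = b ; a∈ends = a∈ ; b∈ends = b∈ ; a≢b = a≢b
    ; a∈V′ = ∈V′⁺ (ends⊆V a∈) (a∉ ∘ here) ; b∈V′ = ∈V′⁺ (ends⊆V b∈) (b∉ ∘ here)
    ; beats-a = out⇒beats (i , refl , a∈) ; beats-b = out⇒beats (i , refl , b∈) }

  link : Σ (Design (complete V′ u′) (path 3)) (DownLink 𝓑)
  link = path-link deg-even (λ i → ∈V′⁺ (mid∈V i) (mid≢z i)) choice

order-2k⇒𝓛₂ : ∀ {k n} → k > 3 → n ≥ 2 * k ∸ 1 → HasMod4 n → 𝓛₂ (star k) (2 * k) n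
order-2k⇒𝓛₂ {k@(suc _)} k>3 n≥ mod4 with m≤n⇒m<n∨m≡n n≥
-- As `k` is a successor, `2 * k ∸ 1 < n` computes to `2 * k ≤ n`.
... | inj₁ n> = large⇒𝓛₂ k>3 z<s n> mod4
... | inj₂ refl = λ V u order 𝓑 → let open OrderMinusOne k>3 mod4 order 𝓑 in V′ , u′ , order′ , link

theorem5p4 : ∀ (k : ℕ) → k > 3 →
    (𝓛₂ (star k) (2 * k) ≐ (λ n → n ≥ 2 * k ∸ 1 × (n % 4 ≡ 0 ⊎ n % 4 ≡ 1))) ×
    (∀ (v : ℕ) → v > 2 * k → 2 * k ∣ v * (v ∸ 1) →
    𝓛₂ (star k) v ≐ (λ n → n ≥ v × (n % 4 ≡ 0 ⊎ n % 4 ≡ 1)))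
theorem5p4 k k>3 =
  (𝓛₂⇒ (manyCentres-2k k k>0) , λ (n≥ , mod4) → order-2k⇒𝓛₂ k>3 n≥ mod4) ,
  λ v v>2k 2k∣ → 𝓛₂⇒ (manyCentres k k>0 v v>2k 2k∣) ,
                 λ (n≥v , mod4) → large⇒𝓛₂ k>3 (≤-<-trans z≤n v>2k) n≥v mod4
  where
  k>0 : k > 0
  k>0 = ≤-trans (s≤s z≤n) k>3
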